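{- The problem of deciding, given a graph $G=(V,E)$ of diameter $D$ and a positive integer $k$, whether $G$ has a strong geodetic set of cardinality $k$ is fixed-parameter tractable with respect to the parameters $D$ and $k$ in conjunction.
   Context: All graphs are finite, simple, undirected and connected. The diameter of $G$ is the greatest distance between two of its vertices. A shortest path assignment $I(S)$ of a vertex set $S\subseteq V(G)$ consists of exactly one chosen shortest path of $G$ between $u$ and $v$ for each unordered pair of distinct vertices $u,v\in S$. The set $S$ is a strong geodetic set of $G$ if there is a shortest path assignment $I(S)$ such that every vertex of $V(G)\setminus S$ lies on some path of $I(S)$ (for $|S|\ge 2$ this is the same as $\bigcup_{P\in I(S)}V(P)=V(G)$). A problem is fixed-parameter tractable with respect to $D$ and $k$ in conjunction if it can be solved by an algorithm running in time $\mathcal{O}(f(D,k)\cdot n^{c})$, where $n$ is the size of the input instance, $c$ is a positive constant and $f$ is a computable function. -}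

module Defs where

open import Data.Bool using (Bool; true; false; T)
open import Data.Fin using (Fin; zero; _<_)
open import Data.Fin.Subset using (Subset; _∈_; _∉_; ∣_∣)
open import Data.List using (List; []; _∷_; allFin)
import Data.List.Membership.Propositional as List
open import Data.List.Relation.Unary.Unique.Propositional using (Unique)
open import Data.Nat using (ℕ; zero; suc; _+_; _*_; _^_; _≤_; NonZero)
open import Data.Product using (Σ; ∃-syntax; _×_)
open import Data.Vec using (Vec; lookup; replicate; _[_]≔_; _∷_)
open import Function.Bundles using (_⇔_)
open import Relation.Binary.Definitions using (Symmetric; Irreflexive)
open import Relation.Binary.PropositionalEquality using (_≡_)

infixr 5 _∙_
infix  6 _:=_
infixr 4 _⨾_
infix  3 _⊢_⇓_within_ _[_]⇓_within_

------------------------------------------------------------------------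
-- Model of computation: the WHILE language over binary trees of
-- N. D. Jones (Computability and Complexity, MIT Press 1997), with its
-- unit-cost time measure.  It is Turing complete and polynomially
-- time-equivalent to Turing machines, so that it yields the same
-- fixed-parameter tractable problems.

data Tree : Set where
  nil : Tree
  _∙_ : Tree → Tree → Tree

size : Tree → ℕ
size nil     = 1
size (l ∙ r) = suc (size l + size r)

head tail : Tree → Tree
head nil     = nil
head (l ∙ r) = l
tail nil     = nil
tail (l ∙ r) = r

data Expr (m : ℕ) : Set where
  var  : Fin m → Expr m
  nil  : Expr m
  cons : Expr m → Expr m → Expr m
  hd   : Expr m → Expr m
  tl   : Expr m → Expr m

data Command (m : ℕ) : Set where
  _:=_          : Fin m → Expr m → Command m
  _⨾_           : Command m → Command m → Command m
  if_then_else_ : Expr m → Command m → Command m → Command m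
  while_repeat_ : Expr m → Command m → Command m

Store : ℕ → Set
Store m = Vec Tree m

eval : ∀ {m} → Expr m → Store m → Tree
eval (var x)    σ = lookup σ x
eval nil        σ = nil
eval (cons d e) σ = eval d σ ∙ eval e σ
eval (hd e)     σ = head (eval e σ)
eval (tl e)     σ = tail (eval e σ)

cost : ∀ {m} → Expr m → ℕ
cost (var x)    = 1
cost nil        = 1
cost (cons d e) = suc (cost d + cost e)
cost (hd e)     = suc (cost e)
cost (tl e)     = suc (cost e)

-- σ ⊢ c ⇓ σ′ within t : started in σ, the command c halts in σ′ after
-- exactly t time units.  In tests, nil is false and all else is true.

data _⊢_⇓_within_ {m : ℕ} (σ : Store m) : Command m → Store m → ℕ → Set where

  assign : ∀ {x e} →
           σ ⊢ x := e ⇓ σ [ x ]≔ eval e σ within suc (cost e)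

  seq : ∀ {c₁ c₂ σ₁ σ₂ t₁ t₂} →
        σ ⊢ c₁ ⇓ σ₁ within t₁ →
        σ₁ ⊢ c₂ ⇓ σ₂ within t₂ →
        σ ⊢ c₁ ⨾ c₂ ⇓ σ₂ within t₁ + t₂

  if-true : ∀ {e c₁ c₂ l r σ₁ t} →
            eval e σ ≡ l ∙ r →
            σ ⊢ c₁ ⇓ σ₁ within t →
            σ ⊢ if e then c₁ else c₂ ⇓ σ₁ within suc (cost e) + t

  if-false : ∀ {e c₁ c₂ σ₂ t} →
             eval e σ ≡ nil →
             σ ⊢ c₂ ⇓ σ₂ within t →
             σ ⊢ if e then c₁ else c₂ ⇓ σ₂ within suc (cost e) + t

  while-true : ∀ {e c l r σ₁ σ₂ t₁ t₂} →
               eval e σ ≡ l ∙ r →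
               σ ⊢ c ⇓ σ₁ within t₁ →
               σ₁ ⊢ while e repeat c ⇓ σ₂ within t₂ →
               σ ⊢ while e repeat c ⇓ σ₂ within suc (cost e) + (t₁ + t₂)

  while-false : ∀ {e c} →
                eval e σ ≡ nil →
                σ ⊢ while e repeat c ⇓ σ within suc (cost e)

-- Variable zero holds the input at the start and the output at the end;
-- the other variables are initially nil.

record Program : Set where
  field
    auxiliary : ℕ
    body      : Command (suc auxiliary)

_[_]⇓_within_ : Program → Tree → Tree → ℕ → Set
p [ input ]⇓ output within t =
  ∃[ σ ] (input ∷ replicate auxiliary nil) ⊢ body ⇓ σ within t
         × lookup σ zero ≡ output
  where open Program p

encodeBool : Bool → Tree
encodeBool false = nil
encodeBool true  = nil ∙ nil

encodeℕ : ℕ → Tree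
encodeℕ zero    = nil
encodeℕ (suc n) = nil ∙ encodeℕ n

encodeList : ∀ {A : Set} → (A → Tree) → List A → Tree
encodeList enc []       = nil
encodeList enc (x ∷ xs) = enc x ∙ encodeList enc xs

------------------------------------------------------------------------
-- Parameterized complexity

Computable : (ℕ → ℕ → ℕ) → Set
Computable f =
  ∃[ p ] ∀ a b → ∃[ t ] p [ encodeℕ a ∙ encodeℕ b ]⇓ encodeℕ (f a b) within t

-- The parameters are functions of the instance; a program receives only
-- the encoded instance.

record ParameterizedProblem : Set₁ where
  field
    Instance    : Set
    encode      : Instance → Tree
    parameter₁  : Instance → ℕ
    parameter₂  : Instance → ℕ
    YesInstance : Instance → Set

FixedParameterTractable : ParameterizedProblem → Set
FixedParameterTractable P =
  Σ Program λ p → Σ (ℕ → ℕ → ℕ) λ f → Σ ℕ λ c → Σ ℕ λ C →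
    Computable f
    × NonZero c
    × (∀ (i : Instance) → Σ Bool λ answer → Σ ℕ λ t →
         p [ encode i ]⇓ encodeBool answer within t
         × (T answer ⇔ YesInstance i)
         × t ≤ C * (f (parameter₁ i) (parameter₂ i) * size (encode i) ^ c))
  where open ParameterizedProblem P

------------------------------------------------------------------------
-- Graphs

record Graph : Set where
  field
    order : ℕ
    adj   : Fin order → Fin order → Bool

  Vertex : Set
  Vertex = Fin order

  _~_ : Vertex → Vertex → Set
  u ~ v = T (adj u v)

  field
    ~-irrefl : Irreflexive _≡_ _~_
    ~-sym    : Symmetric _~_

module _ (G : Graph) where
  open Graph G

  data Walk : Vertex → Vertex → Set where
    []  : ∀ {u} → Walk u u
    _∷_ : ∀ {u v w} → u ~ v → Walk v w → Walk u w

  walkVertices : ∀ {u v} → Walk u v → List Vertex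
  walkVertices {u} []      = u ∷ []
  walkVertices {u} (e ∷ w) = u ∷ walkVertices w

  walkLength : ∀ {u v} → Walk u v → ℕ
  walkLength []      = 0
  walkLength (e ∷ w) = suc (walkLength w)

  record Path (u v : Vertex) : Set where
    field
      walk   : Walk u v
      simple : Unique (walkVertices walk)

    vertices : List Vertex
    vertices = walkVertices walk

    length : ℕ
    length = walkLength walk

  open Path

  Connected : Set
  Connected = ∀ u v → Path u v

  record ShortestPath (u v : Vertex) : Set where
    field
      path     : Path u v
      shortest : ∀ (q : Path u v) → length path ≤ length q

  open ShortestPath

  IsDistance : Vertex → Vertex → ℕ → Set
  IsDistance u v d = Σ (ShortestPath u v) λ p → length (path p) ≡ d

  IsDiameter : ℕ → Set
  IsDiameter D = (∃[ u ] ∃[ v ] IsDistance u v D)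
               × (∀ u v d → IsDistance u v d → d ≤ D)

  -- An unordered pair of distinct vertices is represented by the pair
  -- (u , v) with u < v.

  ShortestPathAssignment : Subset order → Set
  ShortestPathAssignment S =
    ∀ u v → u ∈ S → v ∈ S → u < v → ShortestPath u v

  IsStrongGeodetic : Subset order → Set
  IsStrongGeodetic S =
    Σ (ShortestPathAssignment S) λ I →
      ∀ x → x ∉ S →
        ∃[ u ] ∃[ v ] Σ (u ∈ S) λ u∈S → Σ (v ∈ S) λ v∈S → Σ (u < v) λ u<v →
          x List.∈ vertices (path (I u v u∈S v∈S u<v))

  encodeGraph : Tree
  encodeGraph =
    encodeList (λ u → encodeList (λ v → encodeBool (adj u v)) (allFin order))
               (allFin order)

------------------------------------------------------------------------
-- The decision problem

-- The diameter, being determined by the graph, is not part of the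
-- encoding.  An empty graph has no diameter and hence is not an instance.

record SGSInstance : Set where
  field
    graph      : Graph
    connected  : Connected graph
    D          : ℕ
    isDiameter : IsDiameter graph D
    k          : ℕ
    k-positive : NonZero k

-- The number k is written in unary, as is usual for a parameter: changing
-- to binary costs time depending on k only.

StrongGeodeticSet : ParameterizedProblem
StrongGeodeticSet = record
  { Instance    = SGSInstance
  ; encode      = λ i → encodeGraph (graph i) ∙ encodeℕ (k i)
  ; parameter₁  = D
  ; parameter₂  = k
  ; YesInstance = λ i →
      ∃[ S ] ∣ S ∣ ≡ k i × IsStrongGeodetic (graph i) S
  }
  where open SGSInstance

{-# OPTIONS --safe #-}

-- A strong geodetic set of size k in a graph of diameter D covers at most
-- k + k²(D + 1) vertices.  The program finds the eccentricity e ≤ D ≤ 2e of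
-- one vertex by breadth-first search, so 2k²(e + 1) bounds the order of every
-- yes-instance.  If that bound holds, all vertices, paths and path assignments
-- are trees of height at most 8k²(e + 1), and being a yes-instance is a
-- first-order property of the graph with quantifiers ranging over all these
-- trees.  The evaluation of a fixed formula by nested loops is polynomial in
-- the size of its domain.  The number of trees up to a height is at least
-- squared when the height grows by one, so this polynomial is absorbed into
-- the number of trees of a slightly larger height, which serves as f(D, k).
module Submission where

open import Data.Bool using (Bool; true; false; T)
open import Data.Bool.Properties using (T?)
open import Data.Empty using (⊥; ⊥-elim)
open import Data.Fin using (Fin; zero; suc; toℕ; _↑ˡ_; fromℕ<)
import Data.Fin as Fin
import Data.Fin.Properties as Fin
open import Data.Fin.Subset using (Subset; ∣_∣)
import Data.Fin.Subset as Subset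
open import Data.Fin.Subset.Properties using (∉⊥; ∣⊥∣≡0; _∈?_)
open import Data.List using (List; []; _∷_; map; length; allFin; concatMap; tabulate)
  renaming (_++_ to _++ᴸ_)
import Data.List as List
open import Data.List.Membership.Propositional using (_∈_; find; lose)
open import Data.List.Membership.Propositional.Properties
  using (∈-map⁺; ∈-map⁻; ∈-lookup; ∈-++⁺ˡ; ∈-++⁺ʳ; ∈-concatMap⁺)
open import Data.List.Properties using (length-++; length-map; length-tabulate; map-cong)
open import Data.List.Relation.Unary.All using (All; []; _∷_)
import Data.List.Relation.Unary.All as All
import Data.List.Relation.Unary.All.Properties as All
open import Data.List.Relation.Unary.AllPairs using ([]; _∷_)
open import Data.List.Relation.Unary.Any using (Any; here; there; any?)
import Data.List.Relation.Unary.Any as Any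
import Data.List.Relation.Unary.Any.Properties as Any
open import Data.List.Relation.Unary.Unique.Propositional using (Unique)
import Data.List.Relation.Unary.Unique.Propositional.Properties as Unique
open import Data.Nat hiding (less; equal)
open import Data.Nat.Properties
open import Data.Nat.Tactic.RingSolver using (solve-∀)
open import Data.Product using (Σ; ∃-syntax; _×_; _,_; proj₁; proj₂)
open import Data.Product.Function.NonDependent.Propositional using (_×-⇔_)
open import Data.Sum using (_⊎_; inj₁; inj₂)
open import Data.Sum.Function.Propositional using (_⊎-⇔_)
open import Data.Unit using (⊤; tt)
open import Data.Vec using (Vec; []; _∷_; here; there; lookup; replicate; _++_; _[_]≔_)
open import Data.Vec.Properties using (lookup-++ˡ; []≔-updates; []≔-minimal; []≔-idempotent; []≔-lookup)
import Data.Vec.Relation.Unary.All as Vec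
open import Data.Vec.Relation.Unary.All.Properties using (lookup⁺)
open import Function using (_∘_; id)
open import Function.Bundles using (_⇔_; mk⇔; Equivalence)
open import Function.Construct.Composition using (_⇔-∘_)
open import Function.Construct.Identity using (⇔-id)
open import Relation.Binary.PropositionalEquality hiding ([_])
open import Relation.Nullary using (¬_; Dec; yes; no; does; contradiction; ¬?; _×-dec_)
open import Relation.Nullary.Decidable using (decidable-stable)

open import Defs

-- Trees as lists

-- The obstacle is that `D` is no part of the input, while both the search space and the running
-- time have to be governed by it. The eccentricity `e` of one vertex serves as a substitute:
-- `e ≤ D` keeps the running time below a function of `D` and `k`, and `D ≤ 2e` makes it correct to
-- reject every graph above the order bound. The factor 8 is 4 times 2: over a graph of order n the
-- largest object needed, a table of paths, is a tree of height at most 4n, and n is at most 2k²(e +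
-- 1). Writing the two nontrivial tests (breadth-first step and certificate check) as formulas
-- confines the reasoning about their execution to one compiler; their meaning is then studied
-- without stores. Running times are measured in lengths of lists, not in sizes of trees, since
-- building a pair takes constant time however large its parts are. The function f must itself be
-- computed by a program of the same model. The number of trees up to a height is suitable because
-- it is obtained by running the same loops as in the decision program and counting the result.

len : Tree → ℕ
len nil     = 0
len (_ ∙ r) = suc (len r)

drop : ℕ → Tree → Tree
drop zero    t = t
drop (suc i) t = drop i (tail t)

elements : Tree → List Tree
elements nil     = []
elements (h ∙ r) = h ∷ elements r

-- Quantifiers run over suffixes rather than elements because a suffix shows more: the element
-- itself as its head, the following element, and a position as the length of its tail.
suffixes : Tree → List Tree
suffixes nil       = []
suffixes t@(_ ∙ r) = t ∷ suffixes r

IsCons : Tree → Set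
IsCons nil     = ⊥
IsCons (_ ∙ _) = ⊤

isCons? : ∀ t → Dec (IsCons t)
isCons? nil     = no id
isCons? (_ ∙ _) = yes tt

-- Every list read off from a subtree has at most N entries.
Bounded : ℕ → Tree → Set
Bounded N nil       = ⊤
Bounded N t@(h ∙ r) = Bounded N h × Bounded N r × len t ≤ N

Bounded-mono : ∀ {M N} → M ≤ N → ∀ t → Bounded M t → Bounded N t
Bounded-mono M≤N nil     _           = tt
Bounded-mono M≤N (h ∙ r) (bh , br , l) =
  Bounded-mono M≤N h bh , Bounded-mono M≤N r br , ≤-trans l M≤N

Bounded-len : ∀ {N} t → Bounded N t → len t ≤ N
Bounded-len nil     _           = z≤n
Bounded-len (h ∙ r) (_ , _ , l) = l

Bounded-head : ∀ {N} t → Bounded N t → Bounded N (head t)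
Bounded-head nil     _           = tt
Bounded-head (h ∙ r) (b , _ , _) = b

Bounded-tail : ∀ {N} t → Bounded N t → Bounded N (tail t)
Bounded-tail nil     _           = tt
Bounded-tail (h ∙ r) (_ , b , _) = b

Bounded-drop : ∀ {N} i t → Bounded N t → Bounded N (drop i t)
Bounded-drop zero    t b = b
Bounded-drop (suc i) t b = Bounded-drop i (tail t) (Bounded-tail t b)

BoundedStore : ∀ {m} → ℕ → Store m → Set
BoundedStore N = Vec.All (Bounded N)

BoundedStore-mono : ∀ {m M N} {σ : Store m} → M ≤ N → BoundedStore M σ → BoundedStore N σ
BoundedStore-mono M≤N = Vec.map (Bounded-mono M≤N _)

-- Each `cons` lengthens a list by at most one, so the cost of an expression bounds the growth of
-- all list lengths.
eval-bounded : ∀ {m N} (e : Expr m) {σ} → BoundedStore N σ → Bounded (cost e + N) (eval e σ)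
eval-bounded (var x)    b = Bounded-mono (n≤1+n _) _ (lookup⁺ b x)
eval-bounded nil        b = tt
eval-bounded {N = N} (cons d e) b =
  Bounded-mono (m≤n⇒m≤1+n (+-monoˡ-≤ N (m≤m+n (cost d) (cost e)))) _ (eval-bounded d b) ,
  Bounded-mono (m≤n⇒m≤1+n le) _ (eval-bounded e b) ,
  s≤s (≤-trans (Bounded-len _ (eval-bounded e b)) le)
  where
  le : cost e + N ≤ cost d + cost e + N
  le = +-monoˡ-≤ N (m≤n+m (cost e) (cost d))
eval-bounded (hd e)     b = Bounded-mono (n≤1+n _) _ (Bounded-head _ (eval-bounded e b))
eval-bounded (tl e)     b = Bounded-mono (n≤1+n _) _ (Bounded-tail _ (eval-bounded e b))

-- Executions with time bounds

infix 3 _⊢_⇓_atMost_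

_⊢_⇓_atMost_ : ∀ {m} → Store m → Command m → Store m → ℕ → Set
σ ⊢ c ⇓ σ′ atMost T = ∃[ t ] (σ ⊢ c ⇓ σ′ within t) × t ≤ T

module _ {m} {σ : Store m} where

  relax : ∀ {c σ′ T T′} → T ≤ T′ → σ ⊢ c ⇓ σ′ atMost T → σ ⊢ c ⇓ σ′ atMost T′
  relax T≤T′ (t , r , t≤T) = t , r , ≤-trans t≤T T≤T′

  assign≤ : ∀ {x} e → σ ⊢ x := e ⇓ σ [ x ]≔ eval e σ atMost suc (cost e)
  assign≤ e = _ , assign , ≤-refl

  infixr 4 _⨾≤_
  _⨾≤_ : ∀ {c₁ c₂ σ₁ σ₂ T₁ T₂} → σ ⊢ c₁ ⇓ σ₁ atMost T₁ → σ₁ ⊢ c₂ ⇓ σ₂ atMost T₂ →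
         σ ⊢ c₁ ⨾ c₂ ⇓ σ₂ atMost T₁ + T₂
  (_ , r₁ , l₁) ⨾≤ (_ , r₂ , l₂) = _ , seq r₁ r₂ , +-mono-≤ l₁ l₂

  if-true≤ : ∀ {e c₁ c₂ σ₁ T l r} → eval e σ ≡ l ∙ r → σ ⊢ c₁ ⇓ σ₁ atMost T →
             σ ⊢ if e then c₁ else c₂ ⇓ σ₁ atMost suc (cost e) + T
  if-true≤ {e} eq (_ , r , l) = _ , if-true eq r , +-monoʳ-≤ (suc (cost e)) l

  if-false≤ : ∀ {e c₁ c₂ σ₁ T} → eval e σ ≡ nil → σ ⊢ c₂ ⇓ σ₁ atMost T →
              σ ⊢ if e then c₁ else c₂ ⇓ σ₁ atMost suc (cost e) + T
  if-false≤ {e} eq (_ , r , l) = _ , if-false eq r , +-monoʳ-≤ (suc (cost e)) l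

  while-true≤ : ∀ {e c σ₁ σ₂ T₁ T₂ l r} → eval e σ ≡ l ∙ r →
                σ ⊢ c ⇓ σ₁ atMost T₁ → σ₁ ⊢ while e repeat c ⇓ σ₂ atMost T₂ →
                σ ⊢ while e repeat c ⇓ σ₂ atMost suc (cost e) + (T₁ + T₂)
  while-true≤ {e} eq (_ , r₁ , l₁) (_ , r₂ , l₂) =
    _ , while-true eq r₁ r₂ , +-monoʳ-≤ (suc (cost e)) (+-mono-≤ l₁ l₂)

  while-false≤ : ∀ {e c} → eval e σ ≡ nil → σ ⊢ while e repeat c ⇓ σ atMost suc (cost e)
  while-false≤ eq = _ , while-false eq , ≤-refl

-- Loops over lists

forEach_repeat_ : ∀ {m} → Fin m → Command m → Command m
forEach x repeat c = while var x repeat (c ⨾ x := tl (var x))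

-- The step function is given the whole remaining list, as is the body of a loop; the current
-- element is its head.
fold : {A : Set} → (Tree → A → A) → A → Tree → A
fold f a nil       = a
fold f a t@(_ ∙ r) = fold f (f t a) r

-- The store is st t a when the loop variable holds t and the remaining
-- variables are described by a.
module ForEach {m} {A : Set} (st : Tree → A → Store m) (x : Fin m)
  (get : ∀ t a → lookup (st t a) x ≡ t)
  (put : ∀ t t′ a → st t a [ x ]≔ t′ ≡ st t′ a)
  (c : Command m) (f : Tree → A → A) (T : ℕ)
  (I : Tree → A → Set) (I-step : ∀ {h r a} → I (h ∙ r) a → I r (f (h ∙ r) a))
  (body : ∀ {h r} a → I (h ∙ r) a → st (h ∙ r) a ⊢ c ⇓ st (h ∙ r) (f (h ∙ r) a) atMost T)
  where

  -- A round costs 2 for the test, `T` for the body and 3 for advancing the loop variable; the final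
  -- failing test costs 2.
  forEach : ∀ t a → I t a →
            st t a ⊢ forEach x repeat c ⇓ st nil (fold f a t) atMost len t * (T + 5) + 2
  forEach nil a _ = while-false≤ (get nil a)
  forEach t@(h ∙ r) a i =
    relax le (while-true≤ (get t a) (body a i ⨾≤ step) (forEach r _ (I-step i)))
    where
    b : A
    b = f t a
    step : st t b ⊢ x := tl (var x) ⇓ st r b atMost 3
    step = subst (λ σ → st t b ⊢ x := tl (var x) ⇓ σ atMost 3)
             (trans (cong (λ u → st t b [ x ]≔ tail u) (get t b)) (put t r b))
             (assign≤ {x = x} (tl (var x)))
    le : 2 + ((T + 3) + (len r * (T + 5) + 2)) ≤ len t * (T + 5) + 2
    le = ≤-reflexive (begin
      2 + ((T + 3) + (len r * (T + 5) + 2)) ≡⟨ sym (+-assoc 2 (T + 3) _) ⟩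
      2 + (T + 3) + (len r * (T + 5) + 2)   ≡⟨ cong (_+ (len r * (T + 5) + 2))
                                                 (trans (+-comm 2 (T + 3)) (+-assoc T 3 2)) ⟩
      T + 5 + (len r * (T + 5) + 2)         ≡⟨ sym (+-assoc (T + 5) _ 2) ⟩
      len t * (T + 5) + 2 ∎)
      where open ≡-Reasoning

  forEach≤ : ∀ {M} t a → I t a → len t ≤ M →
             st t a ⊢ forEach x repeat c ⇓ st nil (fold f a t) atMost M * (T + 5) + 2
  forEach≤ t a i t≤M = relax (+-monoˡ-≤ 2 (*-monoˡ-≤ (T + 5) t≤M)) (forEach t a i)

-- Bounded first-order formulas on trees.  The first variable holds a
-- stack of the bound values; the quantifier ranges over the nonempty
-- suffixes of a list.

data Formula (v : ℕ) : Set where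
  test    : Expr (suc v) → Formula v
  neg     : Formula v → Formula v
  _and_   : Formula v → Formula v → Formula v
  some    : Expr (suc v) → Formula v → Formula v
  -- Binds a determined value instead of ranging over candidates: the part of a list from a given
  -- position on. Comparison of numbers and access to matrix cells both reduce to it.
  dropped : Expr (suc v) → Expr (suc v) → Formula v → Formula v

push : ∀ {v} → Tree → Store (suc v) → Store (suc v)
push t (s ∷ g) = (t ∙ s) ∷ g

Holds : ∀ {v} → Formula v → Store (suc v) → Set
Holds (test e)        σ = IsCons (eval e σ)
Holds (neg φ)         σ = ¬ Holds φ σ
Holds (φ and ψ)       σ = Holds φ σ × Holds ψ σ
Holds (some e φ)      σ = Any (λ y → Holds φ (push y σ)) (suffixes (eval e σ))
Holds (dropped d e φ) σ = Holds φ (push (drop (len (eval e σ)) (eval d σ)) σ)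

holds? : ∀ {v} (φ : Formula v) σ → Dec (Holds φ σ)
holds? (test e)        σ = isCons? (eval e σ)
holds? (neg φ)         σ = ¬? (holds? φ σ)
holds? (φ and ψ)       σ = holds? φ σ ×-dec holds? ψ σ
holds? (some e φ)      σ = any? (λ y → holds? φ (push y σ)) _
holds? (dropped d e φ) σ = holds? φ _

truth : ∀ {v} → Formula v → Store (suc v) → Tree
truth φ σ = encodeBool (does (holds? φ σ))

-- Compilation of formulas into commands

-- Register zero is reserved for the truth value, hence the shift by one; `h` counts the registers
-- of the surrounding program, which lie behind those of the formula and are preserved by compiled
-- code.
embed : ∀ h {k} → Expr k → Expr (suc (k + h))
embed h (var x)    = var (suc (x ↑ˡ h))
embed h nil        = nil
embed h (cons d e) = cons (embed h d) (embed h e)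
embed h (hd e)     = hd (embed h e)
embed h (tl e)     = tl (embed h e)

cost-embed : ∀ {h k} (e : Expr k) → cost (embed h e) ≡ cost e
cost-embed (var x)    = refl
cost-embed nil        = refl
cost-embed (cons d e) = cong₂ (λ a b → suc (a + b)) (cost-embed d) (cost-embed e)
cost-embed (hd e)     = cong suc (cost-embed e)
cost-embed (tl e)     = cong suc (cost-embed e)

eval-embed : ∀ {h k r} (e : Expr k) (σ : Store k) (τ : Store h) →
             eval (embed h e) (r ∷ (σ ++ τ)) ≡ eval e σ
eval-embed (var x)    σ τ = lookup-++ˡ σ τ x
eval-embed nil        σ τ = refl
eval-embed (cons d e) σ τ = cong₂ _∙_ (eval-embed d σ τ) (eval-embed e σ τ)
eval-embed (hd e)     σ τ = cong head (eval-embed e σ τ)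
eval-embed (tl e)     σ τ = cong tail (eval-embed e σ τ)

module _ {m : ℕ} where

  result stack : Fin (suc (suc m))
  result = zero
  stack  = suc zero

  yield : Bool → Command (suc (suc m))
  yield false = result := nil
  yield true  = result := cons nil nil

  -- The top of the stack is both the loop variable and the value bound by the quantifier. A witness
  -- empties it, which ends the loop with a true result.
  searchLoop : Command (suc (suc m)) → Command (suc (suc m))
  searchLoop c =
    while hd (var stack) repeat
      (c ⨾
       if var result
         then (stack := cons nil (tl (var stack)))
         else (stack := cons (tl (hd (var stack))) (tl (var stack))))

  -- The top of the stack is a pair of a counter and a list, which lose their first entries together
  -- until the counter is empty.
  dropLoop : Command (suc (suc m))
  dropLoop =
    while hd (hd (var stack)) repeat
      (stack := cons (cons (tl (hd (hd (var stack)))) (tl (tl (hd (var stack)))))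
                     (tl (var stack)))

-- The result variable receives the truth value; the stack is restored.
compile : ∀ h {v} → Formula v → Command (suc (suc (v + h)))
compile h (test e)   = if embed h e then yield true else yield false
compile h (neg φ)    =
  compile h φ ⨾ if var result then yield false else yield true
compile h (φ and ψ)  =
  compile h φ ⨾ if var result then compile h ψ else yield false
compile h (some e φ) =
  stack := cons (embed h e) (var stack) ⨾
  yield false ⨾
  searchLoop (compile h φ) ⨾
  stack := tl (var stack)
compile h (dropped d e φ) =
  stack := cons (cons (embed h e) (embed h d)) (var stack) ⨾
  dropLoop ⨾
  stack := cons (tl (hd (var stack))) (tl (var stack)) ⨾
  compile h φ ⨾
  stack := tl (var stack)

-- `N` bounds the lengths of all lists in the store. Evaluating an expression raises this bound by
-- its cost, and pushing the bound value lengthens the stack by one; so the argument grows only by a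
-- constant per binder.
time : ∀ {v} → Formula v → ℕ → ℕ
time (test e)        N = suc (cost e) + 4
time (neg φ)         N = time φ N + 6
time (φ and ψ)       N = time φ N + (2 + (time ψ N + 2))
time (some e φ)      N =
  (cost e + 3) + (2 + (((cost e + N) * (time φ (suc (cost e + N)) + 12) + 3) + 3))
time (dropped d e φ) N =
  (cost e + cost d + 4) + (((cost e + N) * 17 + 4) + (7 + (time φ (suc (cost d + N)) + 3)))

module _ {h v : ℕ} (g : Vec Tree v) (τ : Store h) where

  private
    ⟪_,_⟫ : Tree → Tree → Store (suc (suc (v + h)))
    ⟪ r , s ⟫ = r ∷ s ∷ (g ++ τ)

  yield≤ : ∀ b {r s} → ⟪ r , s ⟫ ⊢ yield b ⇓ ⟪ encodeBool b , s ⟫ atMost 4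
  yield≤ false = relax (s≤s (s≤s z≤n)) (assign≤ nil)
  yield≤ true  = assign≤ (cons nil nil)

  module _ {c : Command (suc (suc (v + h)))} {P : Tree → Set} {s : Tree} {M T : ℕ}
    (P? : ∀ y → Dec (P y))
    (body : ∀ {r} y → Bounded M y →
            ⟪ r , y ∙ s ⟫ ⊢ c ⇓ ⟪ encodeBool (does (P? y)) , y ∙ s ⟫ atMost T) where

    -- A failing round takes 3 for the test, `T` for the body and 9 for the branch. The successful
    -- round takes 2 less but is followed by a last test, which the summand 3 covers.
    search≤ : ∀ t → Bounded M t →
      ⟪ nil , t ∙ s ⟫ ⊢ searchLoop c ⇓ ⟪ encodeBool (does (any? P? (suffixes t))) , nil ∙ s ⟫
        atMost len t * (T + 12) + 3
    search≤ nil b = while-false≤ refl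
    search≤ t@(x ∙ y) b with P? t | body {nil} t b
    ... | yes _ | run =
      relax le (while-true≤ refl (run ⨾≤ if-true≤ refl (assign≤ _)) (while-false≤ refl))
      where
      le : 3 + (T + 7 + 3) ≤ len t * (T + 12) + 3
      le = begin
        3 + (T + 7 + 3)          ≡⟨ +-comm 3 _ ⟩
        T + 7 + 3 + 3            ≤⟨ +-monoˡ-≤ 3 (begin
          T + 7 + 3                ≡⟨ +-assoc T 7 3 ⟩
          T + 10                   ≤⟨ +-monoʳ-≤ T (m≤m+n 10 2) ⟩
          T + 12                   ≤⟨ m≤m+n (T + 12) _ ⟩
          len t * (T + 12) ∎) ⟩
        len t * (T + 12) + 3 ∎
        where open ≤-Reasoning
    ... | no _ | run =
      relax le (while-true≤ refl (run ⨾≤ if-false≤ refl (assign≤ _))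
                            (search≤ y (Bounded-tail t b)))
      where
      L : ℕ
      L = len y * (T + 12) + 3
      le : 3 + (T + 9 + L) ≤ len t * (T + 12) + 3
      le = ≤-reflexive (begin
        3 + (T + 9 + L)      ≡⟨ sym (+-assoc 3 (T + 9) L) ⟩
        3 + (T + 9) + L      ≡⟨ cong (_+ L) (trans (+-comm 3 (T + 9)) (+-assoc T 9 3)) ⟩
        T + 12 + L           ≡⟨ sym (+-assoc (T + 12) _ 3) ⟩
        len t * (T + 12) + 3 ∎)
        where open ≡-Reasoning

  drop≤ : ∀ {r s} u t →
    ⟪ r , (u ∙ t) ∙ s ⟫ ⊢ dropLoop ⇓ ⟪ r , (nil ∙ drop (len u) t) ∙ s ⟫ atMost len u * 17 + 4
  drop≤ nil t     = while-false≤ refl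
  drop≤ (x ∙ u) t = while-true≤ refl (assign≤ _) (drop≤ u (tail t))

-- The statement is strong enough for induction on the formula: the old result `r` is arbitrary
-- because it is overwritten, and the stack comes back as `s`, so that a compiled subformula can
-- serve as the body of a loop.
compile≤ : ∀ {h v N} (φ : Formula v) {r} s (g : Vec Tree v) (τ : Store h) → BoundedStore N (s ∷ g) →
  (r ∷ s ∷ (g ++ τ)) ⊢ compile h φ ⇓ truth φ (s ∷ g) ∷ s ∷ (g ++ τ) atMost time φ N
compile≤ {h} (test e) {r} s g τ b with eval e (s ∷ g) in eq
... | nil   = relax (≤-reflexive (cong (λ c → suc c + 4) (cost-embed {h} e)))
                (if-false≤ (trans (eval-embed e (s ∷ g) τ) eq) (yield≤ g τ false))
... | _ ∙ _ = relax (≤-reflexive (cong (λ c → suc c + 4) (cost-embed {h} e)))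
                (if-true≤ (trans (eval-embed e (s ∷ g) τ) eq) (yield≤ g τ true))
compile≤ (neg φ) s g τ b with holds? φ (s ∷ g) | compile≤ φ s g τ b
... | yes _ | run = run ⨾≤ if-true≤ refl (yield≤ g τ false)
... | no _  | run = run ⨾≤ if-false≤ refl (yield≤ g τ true)
compile≤ {N = N} (φ and ψ) s g τ b with holds? φ (s ∷ g) | compile≤ φ s g τ b
... | no _  | run = relax (+-monoʳ-≤ _ (+-monoʳ-≤ 2 (m≤n+m 2 _)))
                          (run ⨾≤ if-false≤ refl (assign≤ nil))
... | yes _ | run = relax (+-monoʳ-≤ _ (+-monoʳ-≤ 2 (m≤m+n _ 2)))
                          (run ⨾≤ if-true≤ refl (compile≤ ψ s g τ b))
compile≤ {h} {v} {N} (some e φ) {r} s g τ b =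
  relax le (assign≤ (cons (embed h e) (var stack)) ⨾≤ assign≤ nil ⨾≤ loop ⨾≤ assign≤ (tl (var stack)))
  where
  t : Tree
  t = eval e (s ∷ g)
  M : ℕ
  M = cost e + N
  bt : Bounded M t
  bt = eval-bounded e b
  body : ∀ {r} y → Bounded M y → _
  body {r} y by = compile≤ {N = suc M} φ {r} (y ∙ s) g τ (bs Vec.∷ bg)
    where
    N≤ : N ≤ suc M
    N≤ = m≤n⇒m≤1+n (m≤n+m N (cost e))
    bs : Bounded (suc M) (y ∙ s)
    bs = Bounded-mono (n≤1+n M) y by , Bounded-mono N≤ s (Vec.head b) ,
         s≤s (≤-trans (Bounded-len s (Vec.head b)) (m≤n+m N (cost e)))
    bg : BoundedStore (suc M) g
    bg = BoundedStore-mono N≤ (Vec.tail b)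
  loop : (nil ∷ (eval (embed h e) (r ∷ s ∷ (g ++ τ)) ∙ s) ∷ (g ++ τ)) ⊢ searchLoop (compile h φ)
         ⇓ truth (some e φ) (s ∷ g) ∷ (nil ∙ s) ∷ (g ++ τ)
         atMost len t * (time φ (suc M) + 12) + 3
  loop rewrite eval-embed {r = r} e (s ∷ g) τ =
    search≤ g τ (λ y → holds? φ ((y ∙ s) ∷ g)) body t bt
  le : suc (suc (cost (embed h e) + 1)) + (2 + ((len t * (time φ (suc M) + 12) + 3) + 3)) ≤ time (some e φ) N
  le = +-mono-≤ (≤-reflexive (begin
           suc (suc (cost (embed h e) + 1)) ≡⟨ cong (λ c → suc (suc (c + 1))) (cost-embed e) ⟩
           2 + (cost e + 1)                 ≡⟨ +-comm 2 _ ⟩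
           cost e + 1 + 2                   ≡⟨ +-assoc (cost e) 1 2 ⟩
           cost e + 3 ∎))
         (+-monoʳ-≤ 2 (+-monoˡ-≤ 3 (+-monoˡ-≤ 3 (*-monoˡ-≤ _ (Bounded-len t bt)))))
    where open ≡-Reasoning
compile≤ {h} {v} {N} (dropped d e φ) {r} s g τ b =
  relax le (assign≤ (cons (cons (embed h e) (embed h d)) (var stack)) ⨾≤ loop ⨾≤
            assign≤ (cons (tl (hd (var stack))) (tl (var stack))) ⨾≤ run ⨾≤ assign≤ (tl (var stack)))
  where
  t u : Tree
  t = eval d (s ∷ g)
  u = eval e (s ∷ g)
  M : ℕ
  M = cost d + N
  loop : (r ∷ ((eval (embed h e) (r ∷ s ∷ (g ++ τ)) ∙ eval (embed h d) (r ∷ s ∷ (g ++ τ))) ∙ s) ∷ (g ++ τ))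
         ⊢ dropLoop ⇓ r ∷ ((nil ∙ drop (len u) t) ∙ s) ∷ (g ++ τ) atMost len u * 17 + 4
  loop rewrite eval-embed {r = r} e (s ∷ g) τ | eval-embed {r = r} d (s ∷ g) τ = drop≤ g τ u t
  run : (r ∷ (drop (len u) t ∙ s) ∷ (g ++ τ)) ⊢ compile h φ
        ⇓ truth (dropped d e φ) (s ∷ g) ∷ (drop (len u) t ∙ s) ∷ (g ++ τ) atMost time φ (suc M)
  run = compile≤ φ (drop (len u) t ∙ s) g τ (bs Vec.∷ BoundedStore-mono N≤ (Vec.tail b))
    where
    N≤ : N ≤ suc M
    N≤ = m≤n⇒m≤1+n (m≤n+m N (cost d))
    bs : Bounded (suc M) (drop (len u) t ∙ s)
    bs = Bounded-mono (n≤1+n M) _ (Bounded-drop (len u) t (eval-bounded d b)) ,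
         Bounded-mono N≤ s (Vec.head b) ,
         s≤s (≤-trans (Bounded-len s (Vec.head b)) (m≤n+m N (cost d)))
  le : suc (suc (suc (cost (embed h e) + cost (embed h d)) + 1)) +
       ((len u * 17 + 4) + (7 + (time φ (suc M) + 3))) ≤ time (dropped d e φ) N
  le = +-mono-≤ (≤-reflexive (begin
           suc (suc (suc (cost (embed h e) + cost (embed h d)) + 1))
             ≡⟨ cong₂ (λ a b → suc (suc (suc (a + b) + 1))) (cost-embed {h} e) (cost-embed {h} d) ⟩
           3 + (cost e + cost d + 1)   ≡⟨ +-comm 3 _ ⟩
           cost e + cost d + 1 + 3     ≡⟨ +-assoc (cost e + cost d) 1 3 ⟩
           cost e + cost d + 4 ∎))
         (+-monoˡ-≤ _ (+-monoˡ-≤ 4 (*-monoˡ-≤ 17 (Bounded-len u (eval-bounded e b)))))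
    where open ≡-Reasoning

-- Polynomially bounded functions

*-^ : ∀ m n q → (m * n) ^ q ≡ m ^ q * n ^ q
*-^ m n zero    = refl
*-^ m n (suc q) =
  trans (cong (m * n *_) (*-^ m n q)) ([m*n]*[o*p]≡[m*o]*[n*p] m n (m ^ q) (n ^ q))

-- Turns a sum into a product. This makes shifts of the argument constant factors, and in the end
-- separates the input size from the number of trees.
suc-+-≤ : ∀ c N → suc (c + N) ≤ suc c * suc N
suc-+-≤ c N = begin
  suc (c + N)     ≡⟨ cong suc (+-comm c N) ⟩
  suc N + c       ≤⟨ +-monoʳ-≤ (suc N) (m≤m*n c (suc N)) ⟩
  suc c * suc N   ∎
  where open ≤-Reasoning

-- With base `suc N` in place of `N`, powers increase with the exponent even at zero, so a sum of
-- two bounds may simply add the degrees.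
Polynomial : (ℕ → ℕ) → Set
Polynomial g = ∃[ C ] ∃[ q ] ∀ N → g N ≤ C * suc N ^ q

poly-const : ∀ c → Polynomial (λ _ → c)
poly-const c = c , 0 , λ N → ≤-reflexive (sym (*-identityʳ c))

poly-id : Polynomial id
poly-id = 1 , 1 , λ N → ≤-trans (n≤1+n N) (≤-reflexive (sym (trans (+-identityʳ _) (*-identityʳ (suc N)))))

infixl 6 _+ᵖ_
infixl 7 _*ᵖ_

_+ᵖ_ : ∀ {f g} → Polynomial f → Polynomial g → Polynomial (λ N → f N + g N)
_+ᵖ_ {f} {g} (C , p , bf) (D , q , bg) = C + D , p + q , λ N → begin
  f N + g N                                     ≤⟨ +-mono-≤ (bf N) (bg N) ⟩
  C * suc N ^ p + D * suc N ^ q                 ≤⟨ +-mono-≤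
    (*-monoʳ-≤ C (^-monoʳ-≤ (suc N) (m≤m+n p q))) (*-monoʳ-≤ D (^-monoʳ-≤ (suc N) (m≤n+m q p))) ⟩
  C * suc N ^ (p + q) + D * suc N ^ (p + q)     ≡⟨ sym (*-distribʳ-+ _ C D) ⟩
  (C + D) * suc N ^ (p + q) ∎
  where open ≤-Reasoning

_*ᵖ_ : ∀ {f g} → Polynomial f → Polynomial g → Polynomial (λ N → f N * g N)
_*ᵖ_ {f} {g} (C , p , bf) (D , q , bg) = C * D , p + q , λ N → begin
  f N * g N                             ≤⟨ *-mono-≤ (bf N) (bg N) ⟩
  (C * suc N ^ p) * (D * suc N ^ q)     ≡⟨ [m*n]*[o*p]≡[m*o]*[n*p] C (suc N ^ p) D (suc N ^ q) ⟩
  (C * D) * (suc N ^ p * suc N ^ q)     ≡⟨ cong (C * D *_) (sym (^-distribˡ-+-* (suc N) p q)) ⟩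
  (C * D) * suc N ^ (p + q) ∎
  where open ≤-Reasoning

poly-shift : ∀ {g} c → Polynomial g → Polynomial (λ N → g (c + N))
poly-shift {g} c (C , q , b) = C * suc c ^ q , q , λ N → begin
  g (c + N)                    ≤⟨ b (c + N) ⟩
  C * suc (c + N) ^ q          ≤⟨ *-monoʳ-≤ C (^-monoˡ-≤ q (suc-+-≤ c N)) ⟩
  C * (suc c * suc N) ^ q      ≡⟨ cong (C *_) (*-^ (suc c) (suc N) q) ⟩
  C * (suc c ^ q * suc N ^ q)  ≡⟨ sym (*-assoc C _ _) ⟩
  C * suc c ^ q * suc N ^ q    ∎
  where open ≤-Reasoning

-- For a fixed formula only `some` multiplies two nonconstant terms, one of them linear, and every
-- shift of the argument is a constant of the formula.
poly-time : ∀ {v} (φ : Formula v) → Polynomial (time φ)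
poly-time (test e)        = poly-const _
poly-time (neg φ)         = poly-time φ +ᵖ poly-const 6
poly-time (φ and ψ)       = poly-time φ +ᵖ (poly-const 2 +ᵖ (poly-time ψ +ᵖ poly-const 2))
poly-time (some e φ)      =
  poly-const _ +ᵖ (poly-const 2 +ᵖ
    ((poly-shift (cost e) poly-id *ᵖ (poly-shift (suc (cost e)) (poly-time φ) +ᵖ poly-const 12)
      +ᵖ poly-const 3) +ᵖ poly-const 3))
poly-time (dropped d e φ) =
  poly-const (cost e + cost d + 4) +ᵖ ((poly-shift (cost e) poly-id *ᵖ poly-const 17 +ᵖ poly-const 4) +ᵖ
    (poly-const 7 +ᵖ (poly-shift (suc (cost d)) (poly-time φ) +ᵖ poly-const 3)))

-- Vocabulary of formulas

module _ {v : ℕ} where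

  infixr 6 _or_
  infixr 5 _imp_

  _or_ _imp_ : Formula v → Formula v → Formula v
  φ or ψ  = neg (neg φ and neg ψ)
  φ imp ψ = neg (φ and neg ψ)

  every : Expr (suc v) → Formula v → Formula v
  every e φ = neg (some e (neg φ))

  top : Expr (suc v)
  top = hd (var zero)

  -- Weakening: the expression is read past the value bound last. Only the stack changes under
  -- binding, so the other variables stay as they are.
  below : Expr (suc v) → Expr (suc v)
  below (var zero)    = tl (var zero)
  below (var (suc x)) = var (suc x)
  below nil           = nil
  below (cons d e)    = cons (below d) (below e)
  below (hd e)        = hd (below e)
  below (tl e)        = tl (below e)

  -- Numbers are lengths of lists: one is smaller than another exactly if dropping that many entries
  -- from the longer list leaves something.
  less equal : Expr (suc v) → Expr (suc v) → Formula v
  less d e  = dropped e d (test top)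
  equal d e = neg (less d e) and neg (less e d)

  -- Continues with the suffix of row d of the matrix M that starts at column e.
  entry : Expr (suc v) → Expr (suc v) → Expr (suc v) → Formula v → Formula v
  entry M d e φ = dropped M d (dropped (hd top) (below e) φ)

  distinct : Expr (suc v) → Formula v
  distinct e = every e (neg (some (tl top) (equal (hd top) (hd (below top)))))

  adjacent : Expr (suc v) → Expr (suc v) → Expr (suc v) → Formula v
  adjacent M d e = entry M d e (test (hd top))

  chain : Expr (suc v) → Expr (suc v) → Expr (suc v) → Formula v
  chain M p e = every p
    ((test (tl top) imp adjacent (below M) (hd top) (hd (tl top))) and
     (neg (test (tl top)) imp equal (hd top) (below e)))

  isPath : Expr (suc v) → Expr (suc v) → Expr (suc v) → Expr (suc v) → Formula v
  isPath M p d e = test p and (equal (hd p) d and (distinct p and chain M p e))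

-- Meaning of the vocabulary

-- Every tree stands for some list of numbers, so quantifiers over certificates need no test for
-- well-formedness. Different trees may stand for the same list, which does no harm.
codes : Tree → List ℕ
codes = map len ∘ elements

cell : Tree → ℕ → ℕ → Tree
cell M i j = head (drop j (head (drop i M)))

module _ (A : ℕ → ℕ → Set) where

  -- The empty list is accepted, matching a universal quantifier over no suffixes; it is `PathCode`
  -- that excludes it.
  ChainTo : List ℕ → ℕ → Set
  ChainTo []           y = ⊤
  ChainTo (a ∷ [])     y = a ≡ y
  ChainTo (a ∷ b ∷ xs) y = A a b × ChainTo (b ∷ xs) y

  PathCode : List ℕ → ℕ → ℕ → Set
  PathCode []          x y = ⊥
  PathCode xs@(a ∷ _) x y = a ≡ x × Unique xs × ChainTo xs y

-- Defined for all pairs of numbers: outside the matrix, `drop` and `head` yield `nil`, so such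
-- pairs count as nonadjacent.
Entry : Tree → ℕ → ℕ → Set
Entry M i j = IsCons (cell M i j)

module _ {A : Set} {P Q : A → Set} (P⇔Q : ∀ x → P x ⇔ Q x) where

  open Equivalence

  Any-cong : ∀ xs → Any P xs ⇔ Any Q xs
  Any-cong xs = mk⇔ (Any.map (to (P⇔Q _))) (Any.map (from (P⇔Q _)))

  All-cong : ∀ xs → All P xs ⇔ All Q xs
  All-cong xs = mk⇔ (All.map (to (P⇔Q _))) (All.map (from (P⇔Q _)))

¬-cong : {P Q : Set} → P ⇔ Q → (¬ P) ⇔ (¬ Q)
¬-cong e = mk⇔ (_∘ Equivalence.from e) (_∘ Equivalence.to e)

→-cong : {P Q R S : Set} → P ⇔ Q → R ⇔ S → (P → R) ⇔ (Q → S)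
→-cong e f = mk⇔ (λ h → Equivalence.to f ∘ h ∘ Equivalence.from e)
                 (λ h → Equivalence.from f ∘ h ∘ Equivalence.to e)

isCons-drop : ∀ i t → IsCons (drop i t) ⇔ i < len t
isCons-drop i t = mk⇔ (to i t) (from i t)
  where
  to : ∀ i t → IsCons (drop i t) → i < len t
  to zero    (_ ∙ _) _ = z<s
  to (suc i) nil     c = ⊥-elim (absurd i c)
    where
    absurd : ∀ i → ¬ IsCons (drop i nil)
    absurd zero    = id
    absurd (suc i) = absurd i
  to (suc i) (_ ∙ t) c = s<s (to i t c)
  from : ∀ i t → i < len t → IsCons (drop i t)
  from zero    (_ ∙ _) _         = tt
  from (suc i) (_ ∙ t) (s<s i<n) = from i t i<n

Any-suffixes : ∀ {P : Tree → Set} t → Any (P ∘ head) (suffixes t) ⇔ Any P (elements t)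
Any-suffixes nil     = mk⇔ (λ ()) (λ ())
Any-suffixes (x ∙ r) = mk⇔
  (λ { (here p) → here p ; (there a) → there (Equivalence.to (Any-suffixes r) a) })
  (λ { (here p) → here p ; (there a) → there (Equivalence.from (Any-suffixes r) a) })

All-suffixes : ∀ {P : Tree → Set} t → All (P ∘ head) (suffixes t) ⇔ All P (elements t)
All-suffixes nil     = mk⇔ (λ _ → []) (λ _ → [])
All-suffixes (x ∙ r) = mk⇔
  (λ { (p ∷ a) → p ∷ Equivalence.to (All-suffixes r) a })
  (λ { (p ∷ a) → p ∷ Equivalence.from (All-suffixes r) a })

Any-codes : ∀ {P : ℕ → Set} t → Any (P ∘ len ∘ head) (suffixes t) ⇔ Any P (codes t)
Any-codes t = mk⇔ Any.map⁺ Any.map⁻ ⇔-∘ Any-suffixes t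

All-codes : ∀ {P : ℕ → Set} t → All (P ∘ len ∘ head) (suffixes t) ⇔ All P (codes t)
All-codes t = mk⇔ All.map⁺ All.map⁻ ⇔-∘ All-suffixes t

module _ {v : ℕ} where

  eval-below : ∀ (e : Expr (suc v)) {y} σ → eval (below e) (push y σ) ≡ eval e σ
  eval-below (var zero)    (s ∷ g) = refl
  eval-below (var (suc x)) (s ∷ g) = refl
  eval-below nil           σ = refl
  eval-below (cons d e)    σ = cong₂ _∙_ (eval-below d σ) (eval-below e σ)
  eval-below (hd e)        σ = cong head (eval-below e σ)
  eval-below (tl e)        σ = cong tail (eval-below e σ)

  module _ (φ ψ : Formula v) (σ : Store (suc v)) where

    -- The connectives are defined classically from negation and conjunction; they get their
    -- constructive meaning because truth of a formula is decidable.
    holds-or : Holds (φ or ψ) σ ⇔ (Holds φ σ ⊎ Holds ψ σ)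
    holds-or = mk⇔ to (λ { (inj₁ p) (np , _) → np p ; (inj₂ q) (_ , nq) → nq q })
      where
      to : Holds (φ or ψ) σ → Holds φ σ ⊎ Holds ψ σ
      to h with holds? φ σ
      ... | yes p = inj₁ p
      ... | no np = inj₂ (decidable-stable (holds? ψ σ) (λ nq → h (np , nq)))

    holds-imp : Holds (φ imp ψ) σ ⇔ (Holds φ σ → Holds ψ σ)
    holds-imp = mk⇔ (λ h p → decidable-stable (holds? ψ σ) (λ nq → h (p , nq)))
                    (λ h → λ { (p , nq) → nq (h p) })

  holds-every : ∀ e (φ : Formula v) σ →
    Holds (every e φ) σ ⇔ All (λ y → Holds φ (push y σ)) (suffixes (eval e σ))
  holds-every e φ σ = mk⇔
    (λ h → All.map (decidable-stable (holds? φ _)) (All.¬Any⇒All¬ _ h))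
    (λ a h → All.All¬⇒¬Any (All.map (λ p np → np p) a) h)

  holds-less : ∀ (d e : Expr (suc v)) σ → Holds (less d e) σ ⇔ len (eval d σ) < len (eval e σ)
  holds-less d e (s ∷ g) = isCons-drop _ _

  holds-equal : ∀ (d e : Expr (suc v)) σ → Holds (equal d e) σ ⇔ len (eval d σ) ≡ len (eval e σ)
  holds-equal d e σ =
    mk⇔ (λ { (p , q) → ≤-antisym (≮⇒≥ q) (≮⇒≥ p) })
        (λ eq → <-irrefl eq , <-irrefl (sym eq))
    ⇔-∘ (¬-cong (holds-less d e σ) ×-⇔ ¬-cong (holds-less e d σ))

  holds-adjacent : ∀ (M d e : Expr (suc v)) σ →
    Holds (adjacent M d e) σ ⇔ Entry (eval M σ) (len (eval d σ)) (len (eval e σ))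
  holds-adjacent M d e σ@(s ∷ g)
    rewrite eval-below e {drop (len (eval d σ)) (eval M σ)} σ = ⇔-id _

  holds-distinct : ∀ (e : Expr (suc v)) σ → Holds (distinct e) σ ⇔ Unique (codes (eval e σ))
  holds-distinct e σ@(s ∷ g) = unique (eval e σ) ⇔-∘ (All-cong step _ ⇔-∘ holds-every e clash σ)
    where
    clash : Formula v
    clash = neg (some (tl top) (equal (hd top) (hd (below top))))
    Fresh : Tree → Set
    Fresh y = All (len (head y) ≢_) (codes (tail y))
    step : ∀ y → Holds clash (push y σ) ⇔ Fresh y
    step y = mk⇔ (λ h → All.¬Any⇒All¬ _ (h ∘ Equivalence.from found))
                 (λ a h → All.All¬⇒¬Any a (Equivalence.to found h))
      where
      found : Any (λ z → Holds (equal (hd top) (hd (below top))) (push z (push y σ))) (suffixes (tail y))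
              ⇔ Any (len (head y) ≡_) (codes (tail y))
      found = Any-codes (tail y) ⇔-∘
        Any-cong (λ z → mk⇔ sym sym ⇔-∘ holds-equal (hd top) (hd (below top)) (push z (push y σ))) _
    unique : ∀ t → All Fresh (suffixes t) ⇔ Unique (codes t)
    unique nil     = mk⇔ (λ _ → []) (λ _ → [])
    unique (x ∙ r) = mk⇔ (λ { (p ∷ a) → p ∷ Equivalence.to (unique r) a })
                         (λ { (p ∷ a) → p ∷ Equivalence.from (unique r) a })

  holds-chain : ∀ (M p e : Expr (suc v)) σ →
    Holds (chain M p e) σ ⇔ ChainTo (Entry (eval M σ)) (codes (eval p σ)) (len (eval e σ))
  holds-chain M p e σ@(s ∷ g) = chainTo (eval p σ) ⇔-∘ (All-cong step _ ⇔-∘ holds-every p advance σ)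
    where
    A : ℕ → ℕ → Set
    A = Entry (eval M σ)
    Step : Tree → Set
    Step y = (IsCons (tail y) → A (len (head y)) (len (head (tail y))))
           × (¬ IsCons (tail y) → len (head y) ≡ len (eval e σ))
    follow finish advance : Formula v
    follow = adjacent (below M) (hd top) (hd (tl top))
    finish = equal (hd top) (below e)
    advance = (test (tl top) imp follow) and (neg (test (tl top)) imp finish)
    link : ∀ y → Holds follow (push y σ) ⇔ A (len (head y)) (len (head (tail y)))
    link y = subst (λ m → Holds follow (push y σ) ⇔ Entry m (len (head y)) (len (head (tail y))))
                   (eval-below M {y} σ)
                   (holds-adjacent (below M) (hd top) (hd (tl top)) (push y σ))
    end : ∀ y → Holds finish (push y σ) ⇔ len (head y) ≡ len (eval e σ)
    end y = subst (λ m → Holds finish (push y σ) ⇔ len (head y) ≡ len m)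
                  (eval-below e {y} σ) (holds-equal (hd top) (below e) (push y σ))
    step : ∀ y → Holds advance (push y σ) ⇔ Step y
    step y = (→-cong (⇔-id _) (link y) ⇔-∘ holds-imp (test (tl top)) follow (push y σ))
         ×-⇔ (→-cong (⇔-id _) (end y) ⇔-∘ holds-imp (neg (test (tl top))) finish (push y σ))
    chainTo : ∀ t → All Step (suffixes t) ⇔ ChainTo A (codes t) (len (eval e σ))
    chainTo nil             = mk⇔ (λ _ → tt) (λ _ → [])
    chainTo (x ∙ nil)       = mk⇔ (λ { ((_ , p) ∷ []) → p id }) (λ p → ((λ ()) , λ _ → p) ∷ [])
    chainTo (x ∙ r@(_ ∙ _)) = extend (chainTo r)
      where
      extend : All Step (suffixes r) ⇔ ChainTo A (codes r) (len (eval e σ)) →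
               All Step (suffixes (x ∙ r)) ⇔ ChainTo A (codes (x ∙ r)) (len (eval e σ))
      extend ih = mk⇔
        (λ { ((p , _) ∷ a) → p tt , Equivalence.to ih a })
        (λ { (p , a) → ((λ _ → p) , λ n → ⊥-elim (n tt)) ∷ Equivalence.from ih a })

  holds-isPath : ∀ (M p d e : Expr (suc v)) σ →
    Holds (isPath M p d e) σ ⇔
    PathCode (Entry (eval M σ)) (codes (eval p σ)) (len (eval d σ)) (len (eval e σ))
  holds-isPath M p d e σ =
    pathCode (eval p σ) ⇔-∘
    (⇔-id _ ×-⇔ (holds-equal (hd p) d σ ×-⇔ (holds-distinct p σ ×-⇔ holds-chain M p e σ)))
    where
    pathCode : ∀ t {x y} → (IsCons t × len (head t) ≡ x × Unique (codes t) × ChainTo (Entry (eval M σ)) (codes t) y)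
                           ⇔ PathCode (Entry (eval M σ)) (codes t) x y
    pathCode nil     = mk⇔ proj₁ ⊥-elim
    pathCode (_ ∙ _) = mk⇔ proj₂ (tt ,_)

-- The tails of the suffixes of a list of length n have the lengths n - 1 down to 0, each exactly
-- once. Quantifying over them is quantifying over all vertices.
Any-tails : ∀ {P : ℕ → Set} t → Any (P ∘ len ∘ tail) (suffixes t) ⇔ (∃[ x ] x < len t × P x)
Any-tails {P} t = mk⇔ (to t) (λ { (x , x<n , p) → from t x x<n p })
  where
  to : ∀ t → Any (P ∘ len ∘ tail) (suffixes t) → ∃[ x ] x < len t × P x
  to (_ ∙ r) (here p)  = len r , ≤-refl , p
  to (_ ∙ r) (there a) = let x , x<n , p = to r a in x , m<n⇒m<1+n x<n , p
  from : ∀ t x → x < len t → P x → Any (P ∘ len ∘ tail) (suffixes t)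
  from (_ ∙ r) x x<n p with x ≟ len r
  ... | yes refl = here p
  ... | no x≢    = there (from r x (≤∧≢⇒< (s≤s⁻¹ x<n) x≢) p)

All-tails : ∀ {P : ℕ → Set} t → All (P ∘ len ∘ tail) (suffixes t) ⇔ (∀ x → x < len t → P x)
All-tails {P} t = mk⇔ (to t) (from t)
  where
  to : ∀ t → All (P ∘ len ∘ tail) (suffixes t) → ∀ x → x < len t → P x
  to (_ ∙ r) (p ∷ a) x x<n with x ≟ len r
  ... | yes refl = p
  ... | no x≢    = to r a x (≤∧≢⇒< (s≤s⁻¹ x<n) x≢)
  from : ∀ t → (∀ x → x < len t → P x) → All (P ∘ len ∘ tail) (suffixes t)
  from nil     h = []
  from (_ ∙ r) h = h _ ≤-refl ∷ from r (λ x x<n → h x (m<n⇒m<1+n x<n))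

-- The variables are the rows of the adjacency matrix, the number k, the
-- list of the vertices reached so far, an upper bound for the order of the
-- graph, and the domain from which certificates are drawn.  A number is the
-- length of a list, and a quantifier over vertices runs through the tails
-- of the suffixes of the list of rows.

at : ℕ → Expr 6
at zero    = top
at (suc i) = below (at i)

rows size-k reached bound domain : Expr 6
rows    = var (suc zero)
size-k  = var (suc (suc zero))
reached = var (suc (suc (suc zero)))
bound   = var (suc (suc (suc (suc zero))))
domain  = var (suc (suc (suc (suc (suc zero)))))

-- `reachable` speaks of the vertex bound last. It admits the reached vertices themselves besides
-- their neighbours, so that iteration yields growing closed balls.
unreached reachable : Formula 5
unreached = some rows (neg (some reached (equal (hd (at 0)) (tl (at 1)))))
reachable =
  some reached (equal (hd (at 0)) (tl (at 1)) or adjacent rows (tl (at 1)) (hd (at 0)))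

-- The indices of at reflect that entry binds two values, the second of
-- which starts with the entry.
isShortest assigned covered onPath certificate : Formula 5
isShortest =
  isPath rows (hd (at 0)) (hd (at 3)) (hd (at 2)) and
  every domain (isPath rows (hd (at 0)) (hd (at 4)) (hd (at 3)) imp
                neg (less (hd (at 0)) (hd (at 1))))
assigned =
  every (hd (at 1)) (every (hd (at 2))
    (less (hd (at 1)) (hd (at 0)) imp
     entry (hd (at 2)) (hd (at 1)) (hd (at 0)) isShortest))
onPath =
  some (hd (at 2)) (some (hd (at 3))
    (less (hd (at 1)) (hd (at 0)) and
     entry (hd (at 3)) (hd (at 1)) (hd (at 0))
       (some (hd (at 0)) (equal (hd (at 0)) (tl (at 5))))))
covered = every rows (some (hd (at 2)) (equal (hd (at 0)) (tl (at 1))) or onPath)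
certificate =
  -- Excludes graphs too large for the domain to contain all their paths; below the bound,
  -- comparison with the domain is genuine minimality. No yes-instance is lost by this.
  neg (less bound rows) and
  some domain (some domain
    (equal (hd (at 1)) size-k and
     (every (hd (at 1)) (less (hd (at 0)) rows) and
      (distinct (hd (at 1)) and
       (assigned and covered)))))

-- Meaning of the formulas for search and certificates

module _ (M k D : Tree) where

  -- Minimality is tested only against the paths coded in `D`; it is true minimality as soon as `D`
  -- contains codes of all paths.
  Minimal : Tree → ℕ → ℕ → Set
  Minimal p u v = PathCode (Entry M) (codes p) u v ×
                  All (λ q → PathCode (Entry M) (codes q) u v → ¬ len q < len p) (elements D)

  Covers : Tree → Tree → ℕ → Set
  Covers S P x =
    Any (_≡ x) (codes S) ⊎
    Any (λ u → Any (λ v → u < v × Any (_≡ x) (codes (cell P u v))) (codes S)) (codes S)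

  -- `S` lists the chosen vertices and `P` is a table with one cell for each ordered pair of
  -- vertices. Only the cells at `u < v` with both in `S` are constrained.
  Certifies : Tree → Tree → Set
  Certifies S P =
    len S ≡ len k ×
    All (_< len M) (codes S) ×
    Unique (codes S) ×
    All (λ u → All (λ v → u < v → Minimal (cell P u v) u v) (codes S)) (codes S) ×
    (∀ x → x < len M → Covers S P x)

  module _ (W B s : Tree) where

    private
      σ : Store 6
      σ = s ∷ M ∷ k ∷ W ∷ B ∷ D ∷ []

    holds-unreached : Holds unreached σ ⇔ (∃[ x ] x < len M × ¬ Any (_≡ x) (codes W))
    holds-unreached = Any-tails M ⇔-∘ Any-cong (λ y → ¬-cong
      (Any-codes W ⇔-∘ Any-cong (λ z → holds-equal (hd (at 0)) (tl (at 1)) (push z (push y σ))) _)) _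

    holds-reachable : ∀ y → Holds reachable (push y σ) ⇔
      Any (λ w → w ≡ len (tail y) ⊎ Entry M (len (tail y)) w) (codes W)
    holds-reachable y = Any-codes W ⇔-∘ Any-cong (λ z →
      (holds-equal (hd (at 0)) (tl (at 1)) (push z (push y σ)) ⊎-⇔
       holds-adjacent rows (tl (at 1)) (hd (at 0)) (push z (push y σ))) ⇔-∘
      holds-or (equal (hd (at 0)) (tl (at 1))) (adjacent rows (tl (at 1)) (hd (at 0))) (push z (push y σ))) _

    private module _ (y z : Tree) where

      σ₂ : Store 6
      σ₂ = push z (push y σ)
      S P : Tree
      S = head y
      P = head z

      -- `row` and `column` are the two values that `entry` binds on the way to a cell.
      row : Tree → Tree
      row u = drop (len (head u)) P

      column : Tree → Tree → Tree
      column u v = drop (len (head v)) (head (row u))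

      holds-isShortest : ∀ a b c d → Holds isShortest (push a (push b (push c (push d σ₂)))) ⇔
        Minimal (head a) (len (head d)) (len (head c))
      holds-isShortest a b c d =
        holds-isPath rows (hd (at 0)) (hd (at 3)) (hd (at 2)) σ′ ×-⇔
        (All-suffixes D ⇔-∘ (All-cong (λ q →
           →-cong (holds-isPath rows (hd (at 0)) (hd (at 4)) (hd (at 3)) (push q σ′))
                  (¬-cong (holds-less (hd (at 0)) (hd (at 1)) (push q σ′))) ⇔-∘
           holds-imp (isPath rows (hd (at 0)) (hd (at 4)) (hd (at 3)))
                     (neg (less (hd (at 0)) (hd (at 1)))) (push q σ′)) _ ⇔-∘
         holds-every domain (isPath rows (hd (at 0)) (hd (at 4)) (hd (at 3)) imp
                             neg (less (hd (at 0)) (hd (at 1)))) σ′))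
        where
        σ′ : Store 6
        σ′ = push a (push b (push c (push d σ₂)))

      holds-assigned : Holds assigned σ₂ ⇔
        All (λ u → All (λ v → u < v → Minimal (cell P u v) u v) (codes S)) (codes S)
      holds-assigned =
        All-codes S ⇔-∘ (All-cong (λ u →
          All-codes S ⇔-∘ (All-cong (λ v →
            →-cong (holds-less (hd (at 1)) (hd (at 0)) (push v (push u σ₂)))
                   (holds-isShortest (column u v) (row u) v u) ⇔-∘
            holds-imp (less (hd (at 1)) (hd (at 0)))
                      (entry (hd (at 2)) (hd (at 1)) (hd (at 0)) isShortest) (push v (push u σ₂))) _ ⇔-∘
          holds-every (hd (at 2)) (less (hd (at 1)) (hd (at 0)) imp
             entry (hd (at 2)) (hd (at 1)) (hd (at 0)) isShortest) (push u σ₂))) _ ⇔-∘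
        holds-every (hd (at 1)) (every (hd (at 2)) (less (hd (at 1)) (hd (at 0)) imp
             entry (hd (at 2)) (hd (at 1)) (hd (at 0)) isShortest)) σ₂)

      holds-covered : Holds covered σ₂ ⇔ (∀ x → x < len M → Covers S P x)
      holds-covered =
        All-tails M ⇔-∘ (All-cong (λ x →
          ((Any-codes S ⇔-∘ Any-cong (λ u → holds-equal (hd (at 0)) (tl (at 1)) (push u (push x σ₂))) _)
           ⊎-⇔
           (Any-codes S ⇔-∘ Any-cong (λ u →
             Any-codes S ⇔-∘ Any-cong (λ v →
               holds-less (hd (at 1)) (hd (at 0)) (push v (push u (push x σ₂))) ×-⇔
               (Any-codes (cell P (len (head u)) (len (head v))) ⇔-∘ Any-cong (λ w →
                 holds-equal (hd (at 0)) (tl (at 5))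
                   (push w (push (column u v) (push (row u) (push v (push u (push x σ₂))))))) _)) _) _))
          ⇔-∘ holds-or (some (hd (at 2)) (equal (hd (at 0)) (tl (at 1)))) onPath (push x σ₂)) _ ⇔-∘
        holds-every rows (some (hd (at 2)) (equal (hd (at 0)) (tl (at 1))) or onPath) σ₂)

      holds-certifies : Holds (equal (hd (at 1)) size-k and
        (every (hd (at 1)) (less (hd (at 0)) rows) and
         (distinct (hd (at 1)) and (assigned and covered)))) σ₂ ⇔ Certifies S P
      holds-certifies =
        holds-equal (hd (at 1)) size-k σ₂ ×-⇔
        ((All-codes S ⇔-∘ (All-cong (λ u → holds-less (hd (at 0)) rows (push u σ₂)) _ ⇔-∘
          holds-every (hd (at 1)) (less (hd (at 0)) rows) σ₂)) ×-⇔
         (holds-distinct (hd (at 1)) σ₂ ×-⇔ (holds-assigned ×-⇔ holds-covered)))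

    holds-certificate : Holds certificate σ ⇔
      (¬ len B < len M × Any (λ S → Any (Certifies S) (elements D)) (elements D))
    holds-certificate =
      ¬-cong (holds-less bound rows σ) ×-⇔
      (Any-suffixes D ⇔-∘ Any-cong (λ y →
         Any-suffixes D ⇔-∘ Any-cong (λ z → holds-certifies y z) _) _) 

-- Lists over Fin n

Unique⇒length≤ : ∀ {n} {xs : List (Fin n)} → Unique xs → length xs ≤ n
Unique⇒length≤ {n} {xs} u = Fin.injective⇒≤ {f = List.lookup xs} (lookup-injective u _ _)
  where
  lookup-injective : ∀ {xs : List (Fin n)} → Unique xs → ∀ i j →
                     List.lookup xs i ≡ List.lookup xs j → i ≡ j
  lookup-injective (_ ∷ _) zero    zero    _  = refl
  lookup-injective (a ∷ _) zero    (suc j) eq = contradiction eq (All.lookup a (∈-lookup j))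
  lookup-injective (a ∷ _) (suc i) zero    eq = contradiction (sym eq) (All.lookup a (∈-lookup i))
  lookup-injective (_ ∷ u) (suc i) (suc j) eq = cong suc (lookup-injective u i j eq)

covering⇒≤length : ∀ {n} {xs : List (Fin n)} → (∀ x → x ∈ xs) → n ≤ length xs
covering⇒≤length {n} {xs} c = Fin.injective⇒≤ {f = λ x → Any.index (c x)} λ {x} {y} eq →
  trans (Any.lookup-index (c x)) (trans (cong (List.lookup xs) eq) (sym (Any.lookup-index (c y))))

length-concatMap≤ : ∀ {A B : Set} {b} (f : A → List B) → (∀ x → length (f x) ≤ b) →
                    ∀ xs → length (concatMap f xs) ≤ length xs * b
length-concatMap≤ f f≤ []       = z≤n
length-concatMap≤ f f≤ (x ∷ xs) =
  ≤-trans (≤-reflexive (length-++ (f x)))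
          (+-mono-≤ (f≤ x) (length-concatMap≤ f f≤ xs))

-- Walks and paths

module _ {G : Graph} where
  open Graph G

  append : ∀ {u v w} → Walk G u v → Walk G v w → Walk G u w
  append []      q = q
  append (e ∷ p) q = e ∷ append p q

  length-append : ∀ {u v w} (p : Walk G u v) (q : Walk G v w) →
                  walkLength G (append p q) ≡ walkLength G p + walkLength G q
  length-append []      q = refl
  length-append (e ∷ p) q = cong suc (length-append p q)

  reverse : ∀ {u v} → Walk G u v → Walk G v u
  reverse []      = []
  reverse (e ∷ p) = append (reverse p) (~-sym e ∷ [])

  length-reverse : ∀ {u v} (p : Walk G u v) → walkLength G (reverse p) ≡ walkLength G p
  length-reverse []      = refl
  length-reverse (e ∷ p) =
    trans (length-append (reverse p) _) (trans (+-comm _ 1) (cong suc (length-reverse p)))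

  length-vertices : ∀ {u v} (p : Walk G u v) → length (walkVertices G p) ≡ suc (walkLength G p)
  length-vertices []      = refl
  length-vertices (e ∷ p) = cong suc (length-vertices p)

  SimpleWalk : Vertex → Vertex → ℕ → Set
  SimpleWalk u v d = Σ (Walk G u v) λ w → Unique (walkVertices G w) × walkLength G w ≤ d

  suffixFrom : ∀ {u v x} (w : Walk G u v) → Unique (walkVertices G w) → x ∈ walkVertices G w →
               SimpleWalk x v (walkLength G w)
  suffixFrom []      un       (here refl) = [] , un , z≤n
  suffixFrom (e ∷ w) un       (here refl) = e ∷ w , un , ≤-refl
  suffixFrom (e ∷ w) (_ ∷ un) (there x∈)  =
    let w′ , un′ , l = suffixFrom w un x∈ in w′ , un′ , m≤n⇒m≤1+n l

  -- Loop erasure: the first vertex is put in front of the erased remainder unless it occurs there,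
  -- in which case the remainder is cut back to that occurrence.
  erase : ∀ {u v} (w : Walk G u v) → SimpleWalk u v (walkLength G w)
  erase []                = [] , ([] ∷ []) , z≤n
  erase {u} (_∷_ {v = x} e w) with erase w
  ... | w′ , un , l with any? (u Fin.≟_) (walkVertices G w′)
  ...   | yes u∈ = let w″ , un″ , l″ = suffixFrom w′ un u∈ in
                   w″ , un″ , ≤-trans l″ (m≤n⇒m≤1+n l)
  ...   | no u∉  = e ∷ w′ , (All.¬Any⇒All¬ _ u∉ ∷ un) , s≤s l

  path≤ : ∀ {u v} (w : Walk G u v) → Σ (Path G u v) λ p → Path.length p ≤ walkLength G w
  path≤ w = let w′ , un , l = erase w in record { walk = w′ ; simple = un } , l

  walk? : ∀ d u v → Dec (Σ (Walk G u v) λ w → walkLength G w ≡ d)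
  walk? zero u v with u Fin.≟ v
  ... | yes refl = yes ([] , refl)
  ... | no u≢v   = no λ { ([] , _) → u≢v refl }
  walk? (suc d) u v with Fin.any? (λ x → T? (adj u x) ×-dec walk? d x v)
  ... | yes (x , e , w , l) = yes (e ∷ w , cong suc l)
  ... | no ¬w               = no λ { (_∷_ {v = x} e w , l) → ¬w (x , e , w , suc-injective l) }

  -- The least length of a walk is found by trying all lengths up to that of the given walk. Erasing
  -- loops makes a shortest walk a path without lengthening it.
  shortestPath : ∀ {u v} → Walk G u v → ShortestPath G u v
  shortestPath {u} {v} w with search (suc (walkLength G w))
    where
    Shortest : Set
    Shortest = Σ (Walk G u v) λ s → ∀ (q : Walk G u v) → walkLength G s ≤ walkLength G q
    search : ∀ d → Shortest ⊎ (∀ (q : Walk G u v) → d ≤ walkLength G q)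
    search zero = inj₂ (λ _ → z≤n)
    search (suc d) with search d
    ... | inj₁ s    = inj₁ s
    ... | inj₂ none with walk? d u v
    ...   | yes (s , refl) = inj₁ (s , none)
    ...   | no ¬s          = inj₂ λ q → ≤∧≢⇒< (none q) (λ eq → ¬s (q , sym eq))
  ... | inj₂ none   = ⊥-elim (1+n≰n (none w))
  ... | inj₁ (s , s≤) with path≤ s
  ...   | p , l = record { path = p ; shortest = λ q → ≤-trans l (s≤ (Path.walk q)) }

-- Subsets and lists

members : ∀ {n} → Subset n → List (Fin n)
members []          = []
members (true ∷ S)  = zero ∷ map suc (members S)
members (false ∷ S) = map suc (members S)

length-members : ∀ {n} (S : Subset n) → length (members S) ≡ ∣ S ∣
length-members []          = refl
length-members (true ∷ S)  = cong suc (trans (length-map suc (members S)) (length-members S))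
length-members (false ∷ S) = trans (length-map suc (members S)) (length-members S)

members-unique : ∀ {n} (S : Subset n) → Unique (members S)
members-unique []          = []
members-unique (true ∷ S)  =
  All.map⁺ (All.universal (λ _ ()) _) ∷ Unique.map⁺ Fin.suc-injective (members-unique S)
members-unique (false ∷ S) = Unique.map⁺ Fin.suc-injective (members-unique S)

∈-members⁺ : ∀ {n} {x} {S : Subset n} → x Subset.∈ S → x ∈ members S
∈-members⁺ {S = true ∷ S}  here       = here refl
∈-members⁺ {S = true ∷ S}  (there x∈) = there (∈-map⁺ suc (∈-members⁺ x∈))
∈-members⁺ {S = false ∷ S} (there x∈) = ∈-map⁺ suc (∈-members⁺ x∈)

∈-members⁻ : ∀ {n} {x} {S : Subset n} → x ∈ members S → x Subset.∈ S
∈-members⁻ {S = true ∷ S}  (here refl) = here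
∈-members⁻ {S = true ∷ S}  (there x∈)  with ∈-map⁻ suc x∈
... | _ , y∈ , refl = there (∈-members⁻ y∈)
∈-members⁻ {S = false ∷ S} x∈          with ∈-map⁻ suc x∈
... | _ , y∈ , refl = there (∈-members⁻ y∈)

subset : ∀ {n} → List (Fin n) → Subset n
subset []       = Subset.⊥
subset (x ∷ xs) = subset xs [ x ]≔ true

∈-subset⁺ : ∀ {n} {x : Fin n} {xs} → x ∈ xs → x Subset.∈ subset xs
∈-subset⁺ {xs = y ∷ xs} (here refl) = []≔-updates (subset xs) y
∈-subset⁺ {x = x} {xs = y ∷ xs} (there x∈) with x Fin.≟ y
... | yes refl = []≔-updates (subset xs) y
... | no x≢y   = []≔-minimal (subset xs) x y x≢y (∈-subset⁺ x∈)

∈-subset⁻ : ∀ {n} {x : Fin n} xs → x Subset.∈ subset xs → x ∈ xs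
∈-subset⁻ []           x∈ = ⊥-elim (∉⊥ x∈)
∈-subset⁻ {x = x} (y ∷ xs) x∈ with x Fin.≟ y
... | yes refl = here refl
-- Writing the old value back at `y` restores the subset, and membership of `x` survives because `x`
-- differs from `y`.
... | no x≢y   = there (∈-subset⁻ xs (subst (x Subset.∈_) ([]≔-restore) ([]≔-minimal _ x y x≢y x∈)))
  where
  []≔-restore : subset xs [ y ]≔ true [ y ]≔ lookup (subset xs) y ≡ subset xs
  []≔-restore = trans ([]≔-idempotent (subset xs) y) ([]≔-lookup (subset xs) y)

∣[]≔true∣ : ∀ {n} (S : Subset n) x → ¬ (x Subset.∈ S) → ∣ S [ x ]≔ true ∣ ≡ suc ∣ S ∣
∣[]≔true∣ (true ∷ S)  zero    x∉ = contradiction here x∉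
∣[]≔true∣ (false ∷ S) zero    x∉ = refl
∣[]≔true∣ (true ∷ S)  (suc x) x∉ = cong suc (∣[]≔true∣ S x (x∉ ∘ there))
∣[]≔true∣ (false ∷ S) (suc x) x∉ = ∣[]≔true∣ S x (x∉ ∘ there)

∣subset∣ : ∀ {n} {xs : List (Fin n)} → Unique xs → ∣ subset xs ∣ ≡ length xs
∣subset∣ {n} []   = ∣⊥∣≡0 n
∣subset∣ {xs = x ∷ xs} (a ∷ u) =
  trans (∣[]≔true∣ (subset xs) x (λ x∈ → All.All¬⇒¬Any a (∈-subset⁻ xs x∈))) (cong suc (∣subset∣ u))

-- Encodings

height : Tree → ℕ
height nil     = 0
height (l ∙ r) = suc (height l ⊔ height r)

len-encodeℕ : ∀ n → len (encodeℕ n) ≡ n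
len-encodeℕ zero    = refl
len-encodeℕ (suc n) = cong suc (len-encodeℕ n)

height-encodeℕ : ∀ n → height (encodeℕ n) ≡ n
height-encodeℕ zero    = refl
height-encodeℕ (suc n) = cong suc (height-encodeℕ n)

length-codes : ∀ t → length (codes t) ≡ len t
length-codes nil     = refl
length-codes (_ ∙ r) = cong suc (length-codes r)

module _ {A : Set} (enc : A → Tree) where

  len-encodeList : ∀ xs → len (encodeList enc xs) ≡ length xs
  len-encodeList []       = refl
  len-encodeList (x ∷ xs) = cong suc (len-encodeList xs)

  codes-encodeList : ∀ xs → codes (encodeList enc xs) ≡ map (len ∘ enc) xs
  codes-encodeList []       = refl
  codes-encodeList (x ∷ xs) = cong (_ ∷_) (codes-encodeList xs)

  height-encodeList : ∀ {h} → (∀ x → height (enc x) ≤ h) → ∀ xs → height (encodeList enc xs) ≤ length xs + h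
  height-encodeList e≤ []       = z≤n
  height-encodeList {h} e≤ (x ∷ xs) =
    s≤s (⊔-lub (≤-trans (e≤ x) (m≤n+m h (length xs))) (height-encodeList e≤ xs))

  head-drop-encode : ∀ {n} (f : Fin n → A) i →
                     head (drop (toℕ i) (encodeList enc (tabulate f))) ≡ enc (f i)
  head-drop-encode f zero    = refl
  head-drop-encode f (suc i) = head-drop-encode (f ∘ suc) i

table : ∀ {n} → (Fin n → Fin n → Tree) → Tree
table {n} c = encodeList (λ u → encodeList (c u) (allFin n)) (allFin n)

cell-table : ∀ {n} (c : Fin n → Fin n → Tree) u v → cell (table c) (toℕ u) (toℕ v) ≡ c u v
cell-table {n} c u v
  rewrite head-drop-encode (λ u → encodeList (c u) (allFin n)) id u = head-drop-encode (c u) id v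

isCons-head-drop : ∀ i t → IsCons (head (drop i t)) → i < len t
isCons-head-drop i t c = Equivalence.to (isCons-drop i t) (isCons-head (drop i t) c)
  where
  isCons-head : ∀ t → IsCons (head t) → IsCons t
  isCons-head (_ ∙ _) _ = tt

toℕ-image : ∀ {n i} → i < n → ∃[ x ] toℕ {n} x ≡ i
toℕ-image i<n = fromℕ< i<n , Fin.toℕ-fromℕ< i<n

map-toℕ-image : ∀ {n xs} → All (_< n) xs → ∃[ ys ] map (toℕ {n}) ys ≡ xs
map-toℕ-image []        = [] , refl
map-toℕ-image (x<n ∷ a) with toℕ-image x<n | map-toℕ-image a
... | y , refl | ys , refl = y ∷ ys , refl

Unique-map⁻ : ∀ {A B : Set} {f : A → B} {xs} → Unique (map f xs) → Unique xs
Unique-map⁻ {xs = []}     _       = []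
Unique-map⁻ {xs = x ∷ xs} (a ∷ u) = All.map (λ ≢ eq → ≢ (cong _ eq)) (All.map⁻ a) ∷ Unique-map⁻ u

encodeVertices : ∀ {n} → List (Fin n) → Tree
encodeVertices = encodeList (encodeℕ ∘ toℕ)

codes-encodeVertices : ∀ {n} (xs : List (Fin n)) → codes (encodeVertices xs) ≡ map toℕ xs
codes-encodeVertices xs = trans (codes-encodeList _ xs) (map-cong (len-encodeℕ ∘ toℕ) xs)

-- One `n` accounts for the length of the list, which has no repetitions, the other for the height
-- of the vertex codes.
height-encodeVertices : ∀ {n} (xs : List (Fin n)) → Unique xs → height (encodeVertices xs) ≤ n + n
height-encodeVertices {n} xs un =
  ≤-trans (height-encodeList (encodeℕ ∘ toℕ)
             (λ x → ≤-trans (≤-reflexive (height-encodeℕ (toℕ x))) (Fin.toℕ≤n x)) xs)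
          (+-monoˡ-≤ n (Unique⇒length≤ un))

module _ (G : Graph) where
  open Graph G

  private
    n : ℕ
    n = order
    M : Tree
    M = encodeGraph G

  len-encodeGraph : len M ≡ n
  len-encodeGraph = trans (len-encodeList (λ u → encodeList (encodeBool ∘ adj u) (allFin n)) (allFin n))
                          (length-tabulate id)

  entry⁺ : ∀ {u v} → u ~ v → Entry M (toℕ u) (toℕ v)
  entry⁺ {u} {v} e rewrite cell-table (λ u v → encodeBool (adj u v)) u v with adj u v
  ... | true = tt

  entry⁻ : ∀ {u v} → Entry M (toℕ u) (toℕ v) → u ~ v
  entry⁻ {u} {v} e rewrite cell-table (λ u v → encodeBool (adj u v)) u v with adj u v
  ... | true = tt

  -- Keeps decoded paths inside the graph: a number adjacent to a vertex is again a vertex.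
  entry-column : ∀ {u j} → Entry M (toℕ u) j → j < n
  entry-column {u} {j} e
    rewrite head-drop-encode (λ u → encodeList (encodeBool ∘ adj u) (allFin n)) id u =
    subst (j <_) (trans (len-encodeList (encodeBool ∘ adj u) (allFin n)) (length-tabulate id))
          (isCons-head-drop j _ e)

  chain⁺ : ∀ {u v} (w : Walk G u v) → ChainTo (Entry M) (map toℕ (walkVertices G w)) (toℕ v)
  chain⁺ []               = refl
  chain⁺ (e ∷ [])         = entry⁺ e , refl
  chain⁺ (e ∷ w@(_ ∷ _))  = entry⁺ e , chain⁺ w

  chain⁻ : ∀ {v} u xs → ChainTo (Entry M) (toℕ u ∷ xs) (toℕ v) →
           Σ (Walk G u v) λ w → map toℕ (walkVertices G w) ≡ toℕ u ∷ xs
  chain⁻ u []       eq rewrite Fin.toℕ-injective eq = [] , refl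
  chain⁻ u (x ∷ xs) (e , c) with toℕ-image (entry-column {u} {x} e)
  ... | y , refl = let w , eq = chain⁻ y xs c in entry⁻ e ∷ w , cong (_ ∷_) eq

  pathCode⁺ : ∀ {u v} (p : Path G u v) → PathCode (Entry M) (map toℕ (Path.vertices p)) (toℕ u) (toℕ v)
  pathCode⁺ record { walk = [] ; simple = un } = refl , Unique.map⁺ Fin.toℕ-injective un , refl
  pathCode⁺ record { walk = w@(_ ∷ _) ; simple = un } = refl , Unique.map⁺ Fin.toℕ-injective un , chain⁺ w

  pathCode⁻ : ∀ {u v} xs → PathCode (Entry M) xs (toℕ u) (toℕ v) →
              Σ (Path G u v) λ p → map toℕ (Path.vertices p) ≡ xs
  pathCode⁻ {u} (_ ∷ xs) (refl , un , c) =
    let w , eq = chain⁻ u xs c in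
    record { walk = w ; simple = Unique-map⁻ (subst Unique (sym eq) un) } , eq

-- Certificates and strong geodetic sets

-- An assignment takes membership proofs as arguments. Their uniqueness ensures that a table filled
-- using decided memberships holds the same paths as the given assignment.
∈-irrelevant : ∀ {n x} {S : Subset n} (p q : x Subset.∈ S) → p ≡ q
∈-irrelevant here      here      = refl
∈-irrelevant (there p) (there q) = cong there (∈-irrelevant p q)

module _ (G : Graph) where
  open Graph G
  open ShortestPath using (path; shortest)

  private
    n : ℕ
    n = order
    M : Tree
    M = encodeGraph G

  length-path : ∀ {u v} (p : Path G u v) → length (Path.vertices p) ≡ suc (Path.length p)
  length-path p = length-vertices (Path.walk p)

  module _ (k : Tree) (D : Tree) where

    -- Any competing code decodes to a path of the graph, so it cannot be shorter, whatever trees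
    -- `D` contains.
    minimal⁺ : ∀ {u v} (s : ShortestPath G u v) →
               Minimal M k D (encodeVertices (Path.vertices (path s))) (toℕ u) (toℕ v)
    minimal⁺ {u} {v} s =
      subst (λ xs → PathCode (Entry M) xs (toℕ u) (toℕ v)) (sym (codes-encodeVertices vs)) (pathCode⁺ G (path s)) ,
      All.universal least (elements D)
      where
      vs : List (Fin n)
      vs = Path.vertices (path s)
      least : ∀ q → PathCode (Entry M) (codes q) (toℕ u) (toℕ v) → ¬ len q < len (encodeVertices vs)
      least q c with pathCode⁻ G (codes q) c
      ... | p , eq = ≤⇒≯ (begin
        len (encodeVertices vs)         ≡⟨ len-encodeList (encodeℕ ∘ toℕ) vs ⟩
        length vs                       ≡⟨ length-path (path s) ⟩
        suc (Path.length (path s))      ≤⟨ s≤s (shortest s p) ⟩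
        suc (Path.length p)             ≡⟨ sym (length-path p) ⟩
        length (Path.vertices p)        ≡⟨ sym (length-map toℕ (Path.vertices p)) ⟩
        length (map toℕ (Path.vertices p)) ≡⟨ cong length eq ⟩
        length (codes q)                ≡⟨ length-codes q ⟩
        len q                           ∎)
        where open ≤-Reasoning

    module _ {H} (complete : ∀ t → height t ≤ H → t ∈ elements D)
             (n≤H : n + (n + (n + n)) ≤ H) where

      private
        2n≤H : n + n ≤ H
        2n≤H = ≤-trans (+-monoʳ-≤ n (m≤m+n n (n + n))) n≤H

      -- Here the size of the domain matters: each competing path of the graph has a code of height
      -- at most 2n, which therefore belongs to `D` and was compared.
      minimal⁻ : ∀ {p u v} → Minimal M k D p (toℕ u) (toℕ v) →
                 Σ (ShortestPath G u v) λ s → map toℕ (Path.vertices (path s)) ≡ codes p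
      minimal⁻ {p} {u} {v} (c , least) with pathCode⁻ G (codes p) c
      ... | p̂ , eq = record { path = p̂ ; shortest = least′ } , eq
        where
        least′ : ∀ (q : Path G u v) → Path.length p̂ ≤ Path.length q
        least′ q = s≤s⁻¹ (begin
          suc (Path.length p̂)       ≡⟨ sym (length-path p̂) ⟩
          length (Path.vertices p̂)  ≡⟨ sym (length-map toℕ (Path.vertices p̂)) ⟩
          length (map toℕ (Path.vertices p̂)) ≡⟨ cong length eq ⟩
          length (codes p)          ≡⟨ length-codes p ⟩
          len p                     ≤⟨ ≮⇒≥ (All.lookup least q̂∈
                                         (subst (λ xs → PathCode (Entry M) xs (toℕ u) (toℕ v))
                                            (sym (codes-encodeVertices (Path.vertices q))) (pathCode⁺ G q))) ⟩
          len q̂                     ≡⟨ len-encodeList (encodeℕ ∘ toℕ) (Path.vertices q) ⟩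
          length (Path.vertices q)  ≡⟨ length-path q ⟩
          suc (Path.length q)       ∎)
          where
          open ≤-Reasoning
          q̂ : Tree
          q̂ = encodeVertices (Path.vertices q)
          q̂∈ : q̂ ∈ elements D
          q̂∈ = complete q̂ (≤-trans (height-encodeVertices (Path.vertices q) (Path.simple q)) 2n≤H)

      module _ {S P : Tree} (cert : Certifies M k D S P)
               {L : List (Fin n)} (eq : map toℕ L ≡ codes S) where

        private
          S≡k : len S ≡ len k
          S≡k = proj₁ cert

          un : Unique (codes S)
          un = proj₁ (proj₂ (proj₂ cert))

          min : All (λ u → All (λ v → u < v → Minimal M k D (cell P u v) u v) (codes S)) (codes S)
          min = proj₁ (proj₂ (proj₂ (proj₂ cert)))

          cov : ∀ x → x < len M → Covers M k D S P x
          cov = proj₂ (proj₂ (proj₂ (proj₂ cert)))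

          Ŝ : Subset n
          Ŝ = subset L

          ∣Ŝ∣≡k : ∣ Ŝ ∣ ≡ len k
          ∣Ŝ∣≡k = begin
            ∣ Ŝ ∣                ≡⟨ ∣subset∣ (Unique-map⁻ (subst Unique (sym eq) un)) ⟩
            length L             ≡⟨ sym (length-map toℕ L) ⟩
            length (map toℕ L)   ≡⟨ cong length eq ⟩
            length (codes S)     ≡⟨ length-codes S ⟩
            len S                ≡⟨ S≡k ⟩
            len k                ∎
            where open ≡-Reasoning

          code∈ : ∀ {u} → u Subset.∈ Ŝ → toℕ u ∈ codes S
          code∈ {u} u∈ = subst (toℕ u ∈_) eq (∈-map⁺ toℕ (∈-subset⁻ L u∈))

          decode : ∀ {i} → i ∈ codes S → ∃[ u ] u Subset.∈ Ŝ × i ≡ toℕ u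
          decode {i} i∈ =
            let u , u∈ , eq′ = ∈-map⁻ toℕ (subst (i ∈_) (sym eq) i∈) in u , ∈-subset⁺ u∈ , eq′

          chosen : ∀ {u v} → u Subset.∈ Ŝ → v Subset.∈ Ŝ → u Fin.< v →
                   Σ (ShortestPath G u v) λ s →
                     map toℕ (Path.vertices (path s)) ≡ codes (cell P (toℕ u) (toℕ v))
          chosen u∈ v∈ u<v = minimal⁻ (All.lookup (All.lookup min (code∈ u∈)) (code∈ v∈) u<v)

          OnChosen : Fin n → Set
          OnChosen x = ∃[ u ] ∃[ v ] Σ (u Subset.∈ Ŝ) λ u∈ → Σ (v Subset.∈ Ŝ) λ v∈ →
            Σ (u Fin.< v) λ u<v → x ∈ Path.vertices (path (proj₁ (chosen u∈ v∈ u<v)))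

          onChosen : ∀ {x i j u v} → u Subset.∈ Ŝ → v Subset.∈ Ŝ → i ≡ toℕ u → j ≡ toℕ v →
                     i < j → toℕ x ∈ codes (cell P i j) → OnChosen x
          onChosen {x} u∈ v∈ refl refl u<v x∈ =
            let s , eq′ = chosen u∈ v∈ u<v
                y , y∈ , eq″ = ∈-map⁻ toℕ (subst (toℕ x ∈_) (sym eq′) x∈)
            in _ , _ , u∈ , v∈ , u<v ,
               subst (_∈ Path.vertices (path s)) (sym (Fin.toℕ-injective eq″)) y∈

          covering : ∀ x → x Subset.∉ Ŝ → Covers M k D S P (toℕ x) → OnChosen x
          covering x x∉ (inj₁ x∈) =
            let u , u∈ , eq′ = decode (Any.map sym x∈)
            in contradiction (subst (Subset._∈ Ŝ) (sym (Fin.toℕ-injective eq′)) u∈) x∉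
          covering x x∉ (inj₂ a) =
            let i , i∈ , b       = find a
                j , j∈ , i<j , c = find b
                u , u∈ , i≡      = decode i∈
                v , v∈ , j≡      = decode j∈
            in onChosen u∈ v∈ i≡ j≡ i<j (Any.map sym c)

        decoded : ∃[ Ŝ ] ∣ Ŝ ∣ ≡ len k × IsStrongGeodetic G Ŝ
        decoded = Ŝ , ∣Ŝ∣≡k , (λ u v u∈ v∈ u<v → proj₁ (chosen u∈ v∈ u<v)) , λ x x∉ →
          covering x x∉ (cov (toℕ x) (subst (toℕ x <_) (sym (len-encodeGraph G)) (Fin.toℕ<n x)))

      certificate-sound : ∀ S P → Certifies M k D S P → ∃[ Ŝ ] ∣ Ŝ ∣ ≡ len k × IsStrongGeodetic G Ŝ
      certificate-sound S P c@(_ , S<n , _) =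
        decoded c (proj₂ (map-toℕ-image (subst (λ m → All (_< m) (codes S)) (len-encodeGraph G) S<n)))

  module _ (S : Subset n) (geo : IsStrongGeodetic G S) where

    private
      I : ShortestPathAssignment G S
      I = proj₁ geo

    -- Extends the assignment by empty lists to all ordered pairs, so that a complete table can be
    -- written down.
    pathBetween : ∀ u v → List (Fin n)
    pathBetween u v with u ∈? S | v ∈? S | u Fin.<? v
    ... | yes u∈ | yes v∈ | yes u<v = Path.vertices (path (I u v u∈ v∈ u<v))
    ... | _      | _      | _       = []

    pathBetween-≡ : ∀ {u v} (u∈ : u Subset.∈ S) (v∈ : v Subset.∈ S) (u<v : u Fin.< v) →
                    pathBetween u v ≡ Path.vertices (path (I u v u∈ v∈ u<v))
    pathBetween-≡ {u} {v} u∈ v∈ u<v with u ∈? S | v ∈? S | u Fin.<? v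
    ... | no u∉  | _      | _      = contradiction u∈ u∉
    ... | yes _  | no v∉  | _      = contradiction v∈ v∉
    ... | yes _  | yes _  | no u≮v = contradiction u<v u≮v
    ... | yes p  | yes q  | yes r
      rewrite ∈-irrelevant p u∈ | ∈-irrelevant q v∈ | Fin.<-irrelevant r u<v = refl

    pathBetween-induct : (Q : Fin n → Fin n → List (Fin n) → Set) → (∀ {u v} → Q u v []) →
      (∀ {u v} (s : ShortestPath G u v) → Q u v (Path.vertices (path s))) → ∀ u v → Q u v (pathBetween u v)
    pathBetween-induct Q empty real u v with u ∈? S | v ∈? S | u Fin.<? v
    ... | no _  | _     | _     = empty
    ... | yes _ | no _  | _     = empty
    ... | yes _ | yes _ | no _  = empty
    ... | yes p | yes q | yes r = real (I u v p q r)

    private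
      L : List (Fin n)
      L = members S

    covered-by : ∀ x → x ∈ L ⊎ (∃[ u ] u ∈ L × ∃[ v ] v ∈ L × u Fin.< v × x ∈ pathBetween u v)
    covered-by x with x ∈? S
    ... | yes x∈ = inj₁ (∈-members⁺ x∈)
    ... | no x∉  = let u , v , u∈ , v∈ , u<v , x∈ = proj₂ geo x x∉ in
      inj₂ (u , ∈-members⁺ u∈ , v , ∈-members⁺ v∈ , u<v , subst (x ∈_) (sym (pathBetween-≡ u∈ v∈ u<v)) x∈)

    -- A crude count over all ordered pairs of members, including those to which no path is
    -- assigned; this avoids binomial coefficients.
    order≤ : ∀ {d} → (∀ {u v} (s : ShortestPath G u v) → Path.length (path s) ≤ d) →
             n ≤ ∣ S ∣ + ∣ S ∣ * (∣ S ∣ * suc d)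
    order≤ {d} short = begin
      n                                  ≤⟨ covering⇒≤length covers ⟩
      length (L ++ᴸ concatMap (λ u → concatMap (pathBetween u) L) L)
        ≡⟨ length-++ L ⟩
      length L + length (concatMap (λ u → concatMap (pathBetween u) L) L)
        ≤⟨ +-monoʳ-≤ (length L) (length-concatMap≤ _
             (λ u → length-concatMap≤ (pathBetween u) (pathBetween-induct (λ _ _ xs → length xs ≤ suc d) z≤n
                (λ s → ≤-trans (≤-reflexive (length-path (path s))) (s≤s (short s))) u) L) L) ⟩
      length L + length L * (length L * suc d)
        ≡⟨ cong (λ l → l + l * (l * suc d)) (length-members S) ⟩
      ∣ S ∣ + ∣ S ∣ * (∣ S ∣ * suc d) ∎
      where
      open ≤-Reasoning
      covers : ∀ x → x ∈ L ++ᴸ concatMap (λ u → concatMap (pathBetween u) L) L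
      covers x with covered-by x
      ... | inj₁ x∈ = ∈-++⁺ˡ x∈
      ... | inj₂ (u , u∈ , v , v∈ , _ , x∈) =
        ∈-++⁺ʳ L (∈-concatMap⁺ (λ u → concatMap (pathBetween u) L)
          (lose u∈ (∈-concatMap⁺ (pathBetween u) (lose v∈ x∈))))

    module _ (k D : Tree) (S≡k : ∣ S ∣ ≡ len k) (Ŝ P : Tree) (codesŜ : codes Ŝ ≡ map toℕ L)
             (cellP : ∀ u v → cell P (toℕ u) (toℕ v) ≡ encodeVertices (pathBetween u v)) where

      certifies : Certifies M k D Ŝ P
      certifies =
        lenŜ ,
        subst (All (_< len M)) (sym codesŜ)
          (All.map⁺ (All.universal (λ x → subst (toℕ x <_) (sym (len-encodeGraph G)) (Fin.toℕ<n x)) L)) ,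
        subst Unique (sym codesŜ) (Unique.map⁺ Fin.toℕ-injective (members-unique S)) ,
        All.tabulate (λ i∈ → All.tabulate (λ j∈ → minimal i∈ j∈)) ,
        covers
        where
        lenŜ : len Ŝ ≡ len k
        lenŜ = begin
          len Ŝ               ≡⟨ sym (length-codes Ŝ) ⟩
          length (codes Ŝ)    ≡⟨ cong length codesŜ ⟩
          length (map toℕ L)  ≡⟨ length-map toℕ L ⟩
          length L            ≡⟨ length-members S ⟩
          ∣ S ∣               ≡⟨ S≡k ⟩
          len k               ∎
          where open ≡-Reasoning
        minimal : ∀ {i j} → i ∈ codes Ŝ → j ∈ codes Ŝ → i < j → Minimal M k D (cell P i j) i j
        minimal {i} {j} i∈ j∈ i<j with ∈-map⁻ toℕ (subst (i ∈_) codesŜ i∈) | ∈-map⁻ toℕ (subst (j ∈_) codesŜ j∈)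
        ... | u , u∈ , refl | v , v∈ , refl =
          subst (λ p → Minimal M k D p (toℕ u) (toℕ v))
            (sym (trans (cellP u v) (cong encodeVertices (pathBetween-≡ (∈-members⁻ u∈) (∈-members⁻ v∈) i<j))))
            (minimal⁺ k D (I u v (∈-members⁻ u∈) (∈-members⁻ v∈) i<j))
        code∈ : ∀ {x} → x ∈ L → toℕ x ∈ codes Ŝ
        code∈ {x} x∈ = subst (toℕ x ∈_) (sym codesŜ) (∈-map⁺ toℕ x∈)
        cell∈ : ∀ {x} u v → x ∈ pathBetween u v → toℕ x ∈ codes (cell P (toℕ u) (toℕ v))
        cell∈ {x} u v x∈ =
          subst (toℕ x ∈_) (sym (trans (cong codes (cellP u v)) (codes-encodeVertices (pathBetween u v))))
                (∈-map⁺ toℕ x∈)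
        covers : ∀ i → i < len M → Covers M k D Ŝ P i
        covers i i<n with toℕ-image (subst (i <_) (len-encodeGraph G) i<n)
        ... | x , refl with covered-by x
        ...   | inj₁ x∈ = inj₁ (Any.map sym (code∈ x∈))
        ...   | inj₂ (u , u∈ , v , v∈ , u<v , x∈) =
          inj₂ (lose (code∈ u∈) (lose (code∈ v∈) (u<v , Any.map sym (cell∈ u v x∈))))

    certificate-complete : ∀ k D {H} → (∀ t → height t ≤ H → t ∈ elements D) → n + (n + (n + n)) ≤ H →
      ∣ S ∣ ≡ len k → ∃[ Ŝ ] Ŝ ∈ elements D × ∃[ P ] P ∈ elements D × Certifies M k D Ŝ P
    certificate-complete k D {H} complete n≤H S≡k =
      encodeVertices L ,
      complete _ (≤-trans (height-encodeVertices L (members-unique S))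
                          (≤-trans (+-monoʳ-≤ n (m≤m+n n (n + n))) n≤H)) ,
      table paths ,
      -- A path has height at most 2n, and the columns and the rows of the table add n each: 4n in
      -- total.
      complete _ (≤-trans (height-table (λ u → height-table (height-paths u))) n≤H) ,
      certifies k D S≡k (encodeVertices L) (table paths) (codes-encodeVertices L) (cell-table paths)
      where
      paths : Fin n → Fin n → Tree
      paths u v = encodeVertices (pathBetween u v)
      height-table : ∀ {h} {enc : Fin n → Tree} → (∀ x → height (enc x) ≤ h) →
                     height (encodeList enc (allFin n)) ≤ n + h
      height-table {h} {enc} e≤ = ≤-trans (height-encodeList enc e≤ (allFin n))
                                          (≤-reflexive (cong (_+ h) (length-tabulate {n = n} id)))
      height-paths : ∀ u v → height (paths u v) ≤ n + n
      height-paths = pathBetween-induct (λ _ _ xs → height (encodeVertices xs) ≤ n + n) z≤n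
        (λ s → height-encodeVertices (Path.vertices (path s)) (Path.simple (path s)))

-- The domain of all trees of bounded height

pairWith : Tree → Tree → Tree → Tree
pairWith d y a = fold (λ z b → (head y ∙ head z) ∙ b) a d

-- The accumulator starts as the one-element list containing `nil`, so that `nil` is listed besides
-- all pairs.
square : Tree → Tree
square d = fold (pairWith d) (nil ∙ nil) d

trees : ℕ → Tree
trees zero    = nil ∙ nil
trees (suc h) = square (trees h)

fold-cong : ∀ {A : Set} {f g : Tree → A → A} → (∀ t a → f t a ≡ g t a) → ∀ a t → fold f a t ≡ fold g a t
fold-cong f≗g a nil         = refl
fold-cong {f = f} f≗g a t@(_ ∙ r) = trans (cong (λ b → fold f b r) (f≗g t a)) (fold-cong f≗g _ r)

fold-+ : ∀ m c t → fold (λ _ c → m + c) c t ≡ len t * m + c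
fold-+ m c nil     = refl
fold-+ m c (_ ∙ r) = begin
  fold (λ _ c → m + c) (m + c) r ≡⟨ fold-+ m (m + c) r ⟩
  len r * m + (m + c)            ≡⟨ sym (+-assoc (len r * m) m c) ⟩
  len r * m + m + c              ≡⟨ cong (_+ c) (+-comm (len r * m) m) ⟩
  m + len r * m + c              ∎
  where open ≡-Reasoning

len-pairWith : ∀ d y a → len (pairWith d y a) ≡ len d + len a
len-pairWith d y a = go d a
  where
  go : ∀ t a → len (fold (λ z b → (head y ∙ head z) ∙ b) a t) ≡ len t + len a
  go nil     a = refl
  go (_ ∙ r) a = trans (go r _) (+-suc (len r) (len a))

len-square : ∀ d → len (square d) ≡ suc (len d * len d)
len-square d = trans (go d (nil ∙ nil)) (+-comm (len d * len d) 1)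
  where
  go : ∀ t a → len (fold (pairWith d) a t) ≡ len t * len d + len a
  go nil     a = refl
  go (y ∙ r) a = begin
    len (fold (pairWith d) (pairWith d (y ∙ r) a) r) ≡⟨ go r _ ⟩
    len r * len d + len (pairWith d (y ∙ r) a)       ≡⟨ cong (len r * len d +_) (len-pairWith d (y ∙ r) a) ⟩
    len r * len d + (len d + len a)                  ≡⟨ sym (+-assoc (len r * len d) (len d) (len a)) ⟩
    len r * len d + len d + len a                    ≡⟨ cong (_+ len a) (+-comm (len r * len d) (len d)) ⟩
    len d + len r * len d + len a                    ∎
    where open ≡-Reasoning

module _ (d : Tree) where

  ∈-pairWith-acc : ∀ {x} y t {a} → x ∈ elements a → x ∈ elements (fold (λ z b → (head y ∙ head z) ∙ b) a t)
  ∈-pairWith-acc y nil     x∈ = x∈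
  ∈-pairWith-acc y (z ∙ t) x∈ = ∈-pairWith-acc y t (there x∈)

  ∈-pairWith : ∀ {z} y t {a} → z ∈ elements t →
               head y ∙ z ∈ elements (fold (λ z b → (head y ∙ head z) ∙ b) a t)
  ∈-pairWith y (z ∙ t) (here refl) = ∈-pairWith-acc y t (here refl)
  ∈-pairWith y (_ ∙ t) (there z∈)  = ∈-pairWith y t z∈

  ∈-square-acc : ∀ {x} t {a} → x ∈ elements a → x ∈ elements (fold (pairWith d) a t)
  ∈-square-acc nil     x∈ = x∈
  ∈-square-acc (y ∙ t) x∈ = ∈-square-acc t (∈-pairWith-acc (y ∙ t) d x∈)

  ∈-square : ∀ {y z} t {a} → y ∈ elements t → z ∈ elements d → y ∙ z ∈ elements (fold (pairWith d) a t)
  ∈-square (y ∙ t) (here refl) z∈ = ∈-square-acc t (∈-pairWith (y ∙ t) d z∈)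
  ∈-square (_ ∙ t) (there y∈)  z∈ = ∈-square t y∈ z∈

  module _ {P : Tree → Set} (all-d : All P (elements d)) where

    All-square : {Q : Tree → Set} → (∀ {y z} → P y → P z → Q (y ∙ z)) → Q nil → All Q (elements (square d))
    All-square {Q} pair base = outer d all-d (base ∷ [])
      where
      inner : ∀ y t {a} → P (head y) → All P (elements t) → All Q (elements a) →
              All Q (elements (fold (λ z b → (head y ∙ head z) ∙ b) a t))
      inner y nil     py _        qa = qa
      inner y (z ∙ t) py (pz ∷ p) qa = inner y t py p (pair py pz ∷ qa)
      outer : ∀ t {a} → All P (elements t) → All Q (elements a) → All Q (elements (fold (pairWith d) a t))
      outer nil     _        qa = qa
      outer (y ∙ t) (py ∷ p) qa = outer t p (inner (y ∙ t) d py all-d qa)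

∈-trees : ∀ h t → height t ≤ h → t ∈ elements (trees h)
∈-trees zero    nil     _       = here refl
∈-trees (suc h) nil     _       = ∈-square-acc (trees h) (trees h) (here refl)
∈-trees (suc h) (l ∙ r) (s≤s le) =
  ∈-square (trees h) (trees h) (∈-trees h l (m⊔n≤o⇒m≤o _ _ le)) (∈-trees h r (m⊔n≤o⇒n≤o _ _ le))

trees-elements-bounded : ∀ h → All (Bounded h) (elements (trees h))
trees-elements-bounded zero    = tt ∷ []
trees-elements-bounded (suc h) =
  All-square (trees h) (trees-elements-bounded h) {Bounded (suc h)}
    (λ {y} {z} by bz → Bounded-mono (n≤1+n h) y by , Bounded-mono (n≤1+n h) z bz , s≤s (Bounded-len z bz)) tt

Bounded-elements : ∀ {N} t → All (Bounded N) (elements t) → len t ≤ N → Bounded N t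
Bounded-elements nil     _       _  = tt
Bounded-elements (x ∙ r) (b ∷ a) le = b , Bounded-elements r a (<⇒≤ le) , le

-- The sequence 1, 2, 5, 26, ..., in which each term is the square of the preceding one plus one.
numTrees : ℕ → ℕ
numTrees h = len (trees h)

numTrees-suc : ∀ h → numTrees (suc h) ≡ suc (numTrees h * numTrees h)
numTrees-suc h = len-square (trees h)

-- Allows the number of trees to bound also the counters that occur on the way, such as the height
-- itself and `e`.
h<numTrees : ∀ h → h < numTrees h
h<numTrees zero    = z<s
h<numTrees (suc h) = begin-strict
  suc h                             ≤⟨ h<numTrees h ⟩
  numTrees h                        ≤⟨ m≤m*n (numTrees h) (numTrees h) {{>-nonZero (≤-<-trans z≤n (h<numTrees h))}} ⟩
  numTrees h * numTrees h           <⟨ ≤-refl ⟩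
  suc (numTrees h * numTrees h)     ≡⟨ sym (numTrees-suc h) ⟩
  numTrees (suc h)                  ∎
  where open ≤-Reasoning

numTrees-mono-suc : ∀ h → numTrees h ≤ numTrees (suc h)
numTrees-mono-suc h = begin
  numTrees h                        ≤⟨ m≤m*n (numTrees h) (numTrees h) {{>-nonZero (≤-<-trans z≤n (h<numTrees h))}} ⟩
  numTrees h * numTrees h           ≤⟨ n≤1+n _ ⟩
  suc (numTrees h * numTrees h)     ≡⟨ sym (numTrees-suc h) ⟩
  numTrees (suc h)                  ∎
  where open ≤-Reasoning

numTrees-mono : ∀ {g h} → g ≤ h → numTrees g ≤ numTrees h
numTrees-mono {g} g≤h = go (≤⇒≤′ g≤h)
  where
  go : ∀ {h} → g ≤′ h → numTrees g ≤ numTrees h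
  go ≤′-refl             = ≤-refl
  go {suc h} (≤′-step l) = ≤-trans (go l) (numTrees-mono-suc h)

trees-bounded : ∀ {N} h → numTrees h ≤ N → Bounded N (trees h)
trees-bounded h le = Bounded-elements (trees h)
  (All.map (λ {t} → Bounded-mono (≤-trans (<⇒≤ (h<numTrees h)) le) t) (trees-elements-bounded h)) le

-- numTrees is at least squared when the height grows by one, which makes up
-- for the factor suc.
numTrees-^ : ∀ q h → suc (numTrees h) ^ q ≤ suc (numTrees (q + q + h))
numTrees-^ zero    h = s≤s z≤n
numTrees-^ (suc q) h = begin
  suc (numTrees h) * suc (numTrees h) ^ q   ≤⟨ *-mono-≤ (s≤s (numTrees-mono (m≤n+m h (q + q)))) (numTrees-^ q h) ⟩
  suc (numTrees g) * suc (numTrees g)       ≤⟨ *-mono-≤ suc≤ suc≤ ⟩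
  numTrees (suc g) * numTrees (suc g)       ≤⟨ ≤-trans (n≤1+n _) (n≤1+n _) ⟩
  suc (suc (numTrees (suc g) * numTrees (suc g))) ≡⟨ cong suc (sym (numTrees-suc (suc g))) ⟩
  suc (numTrees (suc (suc g)))              ≡⟨ cong (λ i → suc (numTrees (suc (i + h)))) (sym (+-suc q q)) ⟩
  suc (numTrees (suc q + suc q + h))        ∎
  where
  open ≤-Reasoning
  g : ℕ
  g = q + q + h
  suc≤ : suc (numTrees g) ≤ numTrees (suc g)
  suc≤ = begin
    suc (numTrees g)              ≤⟨ s≤s (m≤m*n (numTrees g) (numTrees g) {{>-nonZero (≤-<-trans z≤n (h<numTrees g))}}) ⟩
    suc (numTrees g * numTrees g) ≡⟨ sym (numTrees-suc g) ⟩
    numTrees (suc g)              ∎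

-- Programs building the domain

pattern #R = zero
pattern #S = suc #R
pattern #M = suc #S
pattern #K = suc #M
pattern #W = suc #K
pattern #B = suc #W
pattern #D = suc #B
pattern #E = suc #D
pattern #H = suc #E
pattern #A = suc #H
pattern #X = suc #A
pattern #Y = suc #X
pattern #Z = suc #Y

nils : ∀ {m} → ℕ → Expr m → Expr m
nils zero    e = e
nils (suc i) e = cons nil (nils i e)

count : ℕ → ℕ → ℕ
count k e = k * (k * suc e)

-- Multiplication by nested loops: each of the k²(e + 1) innermost rounds adds 2 to the order bound
-- `#B` and 8 to the height `#H`. The height is not reset before, so it may start from an offset. In
-- `treesCommand`, `#A` accumulates the next domain.
countCommand treesCommand : Command 13
countCommand =
  #X := var #K ⨾
  forEach #X repeat
    (#Y := var #K ⨾
     forEach #Y repeat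
       (#Z := cons nil (var #E) ⨾
        forEach #Z repeat
          (#B := nils 2 (var #B) ⨾
           #H := nils 8 (var #H))))
treesCommand =
  #D := cons nil nil ⨾
  #X := var #H ⨾
  forEach #X repeat
    (#A := cons nil nil ⨾
     #Y := var #D ⨾
     forEach #Y repeat
       (#Z := var #D ⨾
        forEach #Z repeat (#A := cons (cons (hd (var #Y)) (hd (var #Z))) (var #A))) ⨾
     #D := var #A ⨾
     #A := nil)

-- Each nesting level mirrors one loop with its 5 units per round and 2 at the end. Innermost, 29 is
-- 24 + 5 for the additions of 2 and 8, and 13 is 8 + 5 for the formation of a pair.
countTime treesTime : ℕ → ℕ
countTime N = 2 + (N * (2 + (N * (4 + (N * 29 + 2) + 5) + 2) + 5) + 2)
treesTime N = 4 + (2 + (N * (4 + (2 + ((N * (2 + (N * 13 + 2) + 5) + 2) + (2 + 2))) + 5) + 2))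

module _ {r s M K W E : Tree} where

  module _ {N} (K≤N : len K ≤ N) (E<N : len E < N) (h₀ : ℕ) where

    private
      st : Tree → Tree → Tree → ℕ → Store 13
      st x y z c = r ∷ s ∷ M ∷ K ∷ W ∷ encodeℕ (c * 2) ∷ nil ∷ E ∷ encodeℕ (c * 8 + h₀) ∷ nil ∷ x ∷ y ∷ z ∷ []

      module Z x y = ForEach (st x y) #Z (λ _ _ → refl) (λ _ _ _ → refl)
        (#B := nils 2 (var #B) ⨾ #H := nils 8 (var #H)) (λ _ → suc) 24 (λ _ _ → ⊤) _
        (λ a _ → assign≤ (nils 2 (var #B)) ⨾≤ assign≤ (nils 8 (var #H)))

      module Y x = ForEach (λ y → st x y nil) #Y (λ _ _ → refl) (λ _ _ _ → refl)
        (#Z := cons nil (var #E) ⨾ forEach #Z repeat (#B := nils 2 (var #B) ⨾ #H := nils 8 (var #H)))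
        (λ _ c → fold (λ _ → suc) c (nil ∙ E)) (4 + (N * 29 + 2)) (λ _ _ → ⊤) _
        (λ {h} {r} a _ → assign≤ (cons nil (var #E)) ⨾≤ Z.forEach≤ x (h ∙ r) (nil ∙ E) a tt E<N)

      module X = ForEach (λ x → st x nil nil) #X (λ _ _ → refl) (λ _ _ _ → refl)
        (#Y := var #K ⨾ forEach #Y repeat
          (#Z := cons nil (var #E) ⨾ forEach #Z repeat (#B := nils 2 (var #B) ⨾ #H := nils 8 (var #H))))
        (λ _ c → fold (λ _ c → fold (λ _ → suc) c (nil ∙ E)) c K) (2 + (N * (4 + (N * 29 + 2) + 5) + 2))
        (λ _ _ → ⊤) _
        (λ {h} {r} a _ → assign≤ (var #K) ⨾≤ Y.forEach≤ (h ∙ r) K a tt K≤N)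

      folds : fold (λ _ c → fold (λ _ c → fold (λ _ → suc) c (nil ∙ E)) c K) 0 K ≡ count (len K) (len E)
      folds = begin
        fold (λ _ c → fold (λ _ c → fold (λ _ → suc) c (nil ∙ E)) c K) 0 K
          ≡⟨ fold-cong (λ _ c → trans (fold-cong (λ _ c → trans (fold-+ 1 c (nil ∙ E))
               (cong (_+ c) (*-identityʳ (suc (len E))))) c K) (fold-+ (suc (len E)) c K)) 0 K ⟩
        fold (λ _ c → len K * suc (len E) + c) 0 K ≡⟨ fold-+ (len K * suc (len E)) 0 K ⟩
        count (len K) (len E) + 0                  ≡⟨ +-identityʳ _ ⟩
        count (len K) (len E)                      ∎
        where open ≡-Reasoning

    count≤ : st nil nil nil 0 ⊢ countCommand ⇓ st nil nil nil (count (len K) (len E)) atMost countTime N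
    count≤ = subst (λ c → st nil nil nil 0 ⊢ countCommand ⇓ st nil nil nil c atMost countTime N) folds
      (assign≤ (var #K) ⨾≤ X.forEach≤ K 0 tt K≤N)

  module _ {B : Tree} (H : ℕ) {N} (H≤N : numTrees H ≤ N) where

    private
      st : Tree → Tree → Tree → Tree → Tree → Store 13
      st d x y z a = r ∷ s ∷ M ∷ K ∷ W ∷ B ∷ d ∷ E ∷ encodeℕ H ∷ a ∷ x ∷ y ∷ z ∷ []

      module Z d x y = ForEach (st d x y) #Z (λ _ _ → refl) (λ _ _ _ → refl)
        (#A := cons (cons (hd (var #Y)) (hd (var #Z))) (var #A)) (λ z b → (head y ∙ head z) ∙ b) 8
        (λ _ _ → ⊤) _ (λ _ _ → assign≤ _)

      module Y d (d≤N : len d ≤ N) x = ForEach (λ y → st d x y nil) #Y (λ _ _ → refl) (λ _ _ _ → refl)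
        (#Z := var #D ⨾ forEach #Z repeat (#A := cons (cons (hd (var #Y)) (hd (var #Z))) (var #A)))
        (pairWith d) (2 + (N * 13 + 2)) (λ _ _ → ⊤) _
        (λ {h} {r} a _ → assign≤ (var #D) ⨾≤ Z.forEach≤ d x (h ∙ r) d a tt d≤N)

      small : ∀ {h} → h ≤ H → len (trees h) ≤ N
      small h≤H = ≤-trans (numTrees-mono h≤H) H≤N

      squaring : ∀ u v h → len (trees h) ≤ N →
        st (trees h) (u ∙ v) (trees h) nil (nil ∙ nil) ⊢
        forEach #Y repeat
          (#Z := var #D ⨾
           forEach #Z repeat (#A := cons (cons (hd (var #Y)) (hd (var #Z))) (var #A)))
        ⇓ st (trees h) (u ∙ v) nil nil (square (trees h)) atMost N * (2 + (N * 13 + 2) + 5) + 2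
      squaring u v h d≤N = Y.forEach≤ (trees h) d≤N (u ∙ v) (trees h) (nil ∙ nil) tt d≤N

      module X = ForEach (λ x h → st (trees h) x nil nil nil) #X (λ _ _ → refl) (λ _ _ _ → refl)
        (#A := cons nil nil ⨾
         #Y := var #D ⨾
         forEach #Y repeat
           (#Z := var #D ⨾
            forEach #Z repeat (#A := cons (cons (hd (var #Y)) (hd (var #Z))) (var #A))) ⨾
         #D := var #A ⨾
         #A := nil)
        (λ _ → suc) (4 + (2 + ((N * (2 + (N * 13 + 2) + 5) + 2) + (2 + 2))))
        -- The rounds left and the height reached together stay within `H`, so no intermediate
        -- domain is longer than the final one.
        (λ x h → len x + h ≤ H) (λ {_} {r} {h} → ≤-trans (≤-reflexive (+-suc (len r) h)))
        (λ {u} {v} h le → assign≤ (cons nil nil) ⨾≤ assign≤ (var #D) ⨾≤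
          squaring u v h (small (≤-trans (m≤n+m h _) le)) ⨾≤ assign≤ (var #A) ⨾≤ assign≤ nil)

      folds : fold (λ _ → suc) 0 (encodeℕ H) ≡ H
      folds = trans (fold-+ 1 0 (encodeℕ H)) (trans (+-identityʳ _) (trans (*-identityʳ _) (len-encodeℕ H)))

    trees≤ : ∀ {d} → st d nil nil nil nil ⊢ treesCommand ⇓ st (trees H) nil nil nil nil atMost treesTime N
    trees≤ {d} = subst
      (λ h → st d nil nil nil nil ⊢ treesCommand ⇓ st (trees h) nil nil nil nil atMost treesTime N) folds
      (assign≤ (cons nil nil) ⨾≤ assign≤ (var #H) ⨾≤
       X.forEach≤ (encodeℕ H) 0 (≤-reflexive (trans (+-identityʳ _) (len-encodeℕ H)))
         (≤-trans (≤-reflexive (len-encodeℕ H)) (≤-trans (<⇒≤ (h<numTrees H)) H≤N)))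

-- Computability of the parameter function

module _ (h₀ : ℕ) where

  boundCommand : Command 13
  boundCommand =
    #E := hd (var #R) ⨾
    #K := tl (var #R) ⨾
    #R := nil ⨾
    #H := nils h₀ nil ⨾
    countCommand ⨾
    treesCommand ⨾
    #X := var #D ⨾
    forEach #X repeat (#R := cons nil (var #R))

  boundProgram : Program
  boundProgram = record { auxiliary = 12 ; body = boundCommand }

  -- The offset `h₀` is extra height. It will be twice the degree of the running time, which is what
  -- absorbing the power of the number of trees takes.
  boundFunction : ℕ → ℕ → ℕ
  boundFunction D k = numTrees (count k D * 8 + h₀)

  boundComputable : Computable boundFunction
  boundComputable = boundProgram , computes
    where
    eval-nils : ∀ {m} i (σ : Store m) → eval (nils i nil) σ ≡ encodeℕ i
    eval-nils zero    σ = refl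
    eval-nils (suc i) σ = cong (nil ∙_) (eval-nils i σ)

    computes : ∀ D k → ∃[ t ] boundProgram [ encodeℕ D ∙ encodeℕ k ]⇓ encodeℕ (boundFunction D k) within t
    computes D k =
      let t , run , _ = assign≤ (hd (var #R)) ⨾≤ assign≤ (tl (var #R)) ⨾≤ assign≤ nil ⨾≤ init ⨾≤
                        counting ⨾≤ trees≤ H ≤-refl ⨾≤ assign≤ (var #D) ⨾≤ Out.forEach≤ (trees H) 0 tt ≤-refl
      in t , _ , run , cong encodeℕ (trans (fold-+ 1 0 (trees H)) (trans (+-identityʳ _) (*-identityʳ _)))
      where
      H : ℕ
      H = count k D * 8 + h₀
      start : Tree → Store 13
      start h = nil ∷ nil ∷ nil ∷ encodeℕ k ∷ nil ∷ nil ∷ nil ∷ encodeℕ D ∷ h ∷ nil ∷ nil ∷ nil ∷ nil ∷ []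
      init : start nil ⊢ #H := nils h₀ nil ⇓ start (encodeℕ h₀) atMost suc (cost {13} (nils h₀ nil))
      init = subst (λ h → start nil ⊢ #H := nils h₀ nil ⇓ start h atMost suc (cost {13} (nils h₀ nil)))
                   (eval-nils h₀ (start nil)) (assign≤ (nils h₀ nil))
      counted : ℕ → Store 13
      counted c = nil ∷ nil ∷ nil ∷ encodeℕ k ∷ nil ∷ encodeℕ (c * 2) ∷ nil ∷ encodeℕ D ∷ encodeℕ (c * 8 + h₀) ∷
                  nil ∷ nil ∷ nil ∷ nil ∷ []
      counting : start (encodeℕ h₀) ⊢ countCommand ⇓ counted (count k D) atMost countTime (k + suc D)
      counting = subst₂
        (λ k′ D′ → start (encodeℕ h₀) ⊢ countCommand ⇓ counted (count k′ D′) atMost countTime (k + suc D))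
        (len-encodeℕ k) (len-encodeℕ D)
        (count≤ (≤-trans (≤-reflexive (len-encodeℕ k)) (m≤m+n k (suc D)))
                (≤-trans (s≤s (≤-reflexive (len-encodeℕ D))) (m≤n+m (suc D) k)) h₀)
      module Out = ForEach
        (λ x i → encodeℕ i ∷ nil ∷ nil ∷ encodeℕ k ∷ nil ∷ encodeℕ (count k D * 2) ∷ trees H ∷ encodeℕ D ∷ encodeℕ H ∷
                 nil ∷ x ∷ nil ∷ nil ∷ [])
        #X (λ _ _ → refl) (λ _ _ _ → refl) (#R := cons nil (var #R)) (λ _ → suc) 4 (λ _ _ → ⊤) _
        (λ _ _ → assign≤ (cons nil (var #R)))

-- Breadth-first search from the last vertex

-- The 13 registers are the result, the stack, the five variables of the formulas and six scratch
-- registers; hence the argument 6 of `compile`.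
visitCommand expandCommand searchCommand : Command 13
visitCommand =
  #S := cons (var #X) (var #S) ⨾
  compile 6 reachable ⨾
  -- The else branch stands for doing nothing, as the result is cleared afterwards anyway.
  if var #R then (#A := cons (tl (var #X)) (var #A)) else (#R := nil) ⨾
  #S := tl (var #S) ⨾
  #R := nil
expandCommand =
  #R := nil ⨾
  #X := var #M ⨾
  forEach #X repeat visitCommand ⨾
  #W := var #A ⨾
  #A := nil ⨾
  #E := cons nil (var #E) ⨾
  compile 6 unreached
searchCommand = while var #R repeat expandCommand

visitTime expandTime : ℕ → ℕ
visitTime  N = 4 + (time reachable N + ((2 + 5) + (3 + 2)))
expandTime N = 2 + (2 + ((N * (visitTime N + 5) + 2) + (2 + (2 + (4 + time unreached N)))))

prependIf : {P : Set} → Dec P → Tree → Tree → Tree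
prependIf (yes _) x a = x ∙ a
prependIf (no _)  x a = a

module _ (M K : Tree) where

  view : Tree → Tree → Store 6
  view s W = s ∷ M ∷ K ∷ W ∷ nil ∷ nil ∷ []

  visit : Tree → Tree → Tree → Tree
  visit W y a = prependIf (holds? reachable (push y (view nil W))) (tail y) a

  -- Vertices are coded by tails of suffixes of the rows, so `tail M`, of length n - 1, is the last
  -- vertex. The stages list the closed balls around it.
  within : ℕ → Tree
  within zero    = tail M ∙ nil
  within (suc i) = fold (visit (within i)) nil M

  Near : Tree → ℕ → Set
  Near W x = Any (λ w → w ≡ x ⊎ Entry M x w) (codes W)

  codes-visit : ∀ {P : ℕ → Set} W a t → Any P (codes (fold (visit W) a t)) ⇔
    (Any P (codes a) ⊎ Any (λ y → Holds reachable (push y (view nil W)) × P (len (tail y))) (suffixes t))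
  codes-visit W a nil = mk⇔ inj₁ (λ { (inj₁ p) → p ; (inj₂ ()) })
  codes-visit {P} W a t@(_ ∙ r) =
    head-case (holds? reachable (push t (view nil W))) ⇔-∘ codes-visit W (visit W t a) r
    where
    Q : Tree → Set
    Q y = Holds reachable (push y (view nil W)) × P (len (tail y))
    head-case : (d : Dec (Holds reachable (push t (view nil W)))) →
      (Any P (codes (prependIf d r a)) ⊎ Any Q (suffixes r)) ⇔ (Any P (codes a) ⊎ Any Q (suffixes t))
    head-case (yes h) = mk⇔
      (λ { (inj₁ (here p)) → inj₂ (here (h , p)) ; (inj₁ (there p)) → inj₁ p ; (inj₂ q) → inj₂ (there q) })
      (λ { (inj₁ p) → inj₁ (there p) ; (inj₂ (here (_ , p))) → inj₁ (here p) ; (inj₂ (there q)) → inj₂ q })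
    head-case (no ¬h) = mk⇔
      (λ { (inj₁ p) → inj₁ p ; (inj₂ q) → inj₂ (there q) })
      (λ { (inj₁ p) → inj₁ p ; (inj₂ (here (h , _))) → contradiction h ¬h ; (inj₂ (there q)) → inj₂ q })

  within-suc : ∀ i x → Any (_≡ x) (codes (within (suc i))) ⇔ (x < len M × Near (within i) x)
  within-suc i x =
    mk⇔ (λ { (_ , y<n , near , refl) → y<n , near }) (λ { (x<n , near) → x , x<n , near , refl }) ⇔-∘
    (Any-tails {λ y → Near W y × y ≡ x} M ⇔-∘
    (Any-cong (λ y → holds-reachable M K nil W nil nil y ×-⇔ ⇔-id _) (suffixes M) ⇔-∘
    (mk⇔ (λ { (inj₁ ()) ; (inj₂ q) → q }) inj₂ ⇔-∘ codes-visit W nil M)))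
    where
    W : Tree
    W = within i

  module _ {N} (0<N : 0 < N) (bM : Bounded N M) (bK : Bounded N K) where

    visit-bounded : ∀ {W} a t → Bounded N t → Bounded N a → len t + len a ≤ N →
                    Bounded N (fold (visit W) a t)
    visit-bounded a nil bt ba le = ba
    visit-bounded {W} a t@(_ ∙ r) (_ , br , _) ba le =
      let b , l = head-case (holds? reachable (push t (view nil W))) in visit-bounded (visit W t a) r br b l
      where
      head-case : ∀ {P} (d : Dec P) → Bounded N (prependIf d r a) × len r + len (prependIf d r a) ≤ N
      head-case (yes _) = (br , ba , ≤-trans (s≤s (m≤n+m (len a) (len r))) le) ,
                          ≤-trans (≤-reflexive (+-suc (len r) (len a))) le
      head-case (no _)  = ba , ≤-trans (n≤1+n _) le

    within-bounded : ∀ i → Bounded N (within i)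
    within-bounded zero    = Bounded-tail M bM , tt , 0<N
    within-bounded (suc i) =
      visit-bounded nil M bM tt (≤-trans (≤-reflexive (+-identityʳ _)) (Bounded-len M bM))

    view-bounded : ∀ {s} → Bounded N s → ∀ i → BoundedStore N (view s (within i))
    view-bounded bs i = bs Vec.∷ bM Vec.∷ bK Vec.∷ within-bounded i Vec.∷ tt Vec.∷ tt Vec.∷ Vec.[]

    searching : Tree → ℕ → ℕ → Store 13
    searching r i e = r ∷ (view nil (within i) ++ encodeℕ e ∷ nil ∷ nil ∷ nil ∷ nil ∷ nil ∷ [])

    unreachedAt : ℕ → Tree
    unreachedAt i = truth unreached (view nil (within i))

    visiting : ℕ → Tree → Tree → Store 13
    visiting i x a = nil ∷ (view nil (within i) ++ encodeℕ i ∷ nil ∷ a ∷ x ∷ nil ∷ nil ∷ [])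

    visit≤ : ∀ i {h r} a → Bounded N (h ∙ r) →
      visiting i (h ∙ r) a ⊢ visitCommand ⇓ visiting i (h ∙ r) (visit (within i) (h ∙ r) a) atMost visitTime N
    visit≤ i {h} {r} a b =
      assign≤ (cons (var #X) (var #S)) ⨾≤
      compile≤ {6} {5} {N} reachable ((h ∙ r) ∙ nil) (M ∷ K ∷ within i ∷ nil ∷ nil ∷ [])
        (encodeℕ i ∷ nil ∷ a ∷ (h ∙ r) ∷ nil ∷ nil ∷ []) (view-bounded (b , tt , 0<N) i) ⨾≤
      add≤ (holds? reachable (push (h ∙ r) (view nil (within i))))
      where
      add≤ : ∀ {P} (d : Dec P) →
        encodeBool (does d) ∷ (view ((h ∙ r) ∙ nil) (within i) ++ encodeℕ i ∷ nil ∷ a ∷ (h ∙ r) ∷ nil ∷ nil ∷ []) ⊢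
        (if var #R then (#A := cons (tl (var #X)) (var #A)) else (#R := nil) ⨾ #S := tl (var #S) ⨾ #R := nil)
        ⇓ visiting i (h ∙ r) (prependIf d r a) atMost (2 + 5) + (3 + 2)
      add≤ (yes _) = if-true≤ refl (assign≤ (cons (tl (var #X)) (var #A))) ⨾≤
                     assign≤ (tl (var #S)) ⨾≤ assign≤ nil
      add≤ (no _)  = if-false≤ refl (relax {T′ = 5} (s≤s (s≤s z≤n)) (assign≤ nil)) ⨾≤
                     assign≤ (tl (var #S)) ⨾≤ assign≤ nil

    module Visit (i : ℕ) = ForEach (visiting i) #X (λ _ _ → refl) (λ _ _ _ → refl)
      visitCommand (visit (within i)) (visitTime N)
      (λ t _ → Bounded N t) (λ b → proj₁ (proj₂ b)) (visit≤ i)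

    unreached≤ : ∀ {r} i e → searching r i e ⊢ compile 6 unreached ⇓
      searching (unreachedAt i) i e atMost time unreached N
    unreached≤ i e = compile≤ {6} unreached nil (M ∷ K ∷ within i ∷ nil ∷ nil ∷ [])
      (encodeℕ e ∷ nil ∷ nil ∷ nil ∷ nil ∷ nil ∷ []) (view-bounded tt i)

    expand≤ : ∀ {r} i → searching r i i ⊢ expandCommand ⇓
      searching (unreachedAt (suc i)) (suc i) (suc i) atMost expandTime N
    expand≤ i = assign≤ nil ⨾≤ assign≤ (var #M) ⨾≤ Visit.forEach≤ i M nil bM (Bounded-len M bM) ⨾≤
      assign≤ (var #A) ⨾≤ assign≤ nil ⨾≤ assign≤ (cons nil (var #E)) ⨾≤ unreached≤ (suc i) (suc i)

    Unreached : ℕ → Set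
    Unreached i = Holds unreached (view nil (within i))

    unreached? : ∀ i → Dec (Unreached i)
    unreached? i = holds? unreached (view nil (within i))

    Found : ℕ → ℕ → ℕ → Bool → Set
    Found d j i b = ∃[ e ] e ≤ d × ¬ Unreached e ×
      (searching (encodeBool b) i i ⊢ searchCommand ⇓ searching nil e e atMost j * (2 + expandTime N) + 2)

    -- Termination comes from a radius `d` known in advance to reach every vertex; `j` counts the
    -- rounds left until then. The loop may stop earlier, at the radius `e`.
    search≤′ : ∀ {d} → ¬ Unreached d → ∀ j i → i + j ≡ d → Found d j i (does (unreached? i))
    search≤′ {d} done j i eq = go j eq (unreached? i)
      where
      go : ∀ j → i + j ≡ d → (u : Dec (Unreached i)) → Found d j i (does u)
      go j       eq (no all) =
        i , ≤-trans (m≤m+n i j) (≤-reflexive eq) , all , relax (m≤n+m 2 _) (while-false≤ refl)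
      go zero    eq (yes u)  = contradiction (subst Unreached (trans (sym (+-identityʳ i)) eq) u) done
      go (suc j) eq (yes _)  =
        let e , e≤d , all , run = search≤′ done j (suc i) (trans (sym (+-suc i j)) eq)
        in e , e≤d , all ,
           relax (≤-reflexive (trans (sym (+-assoc 2 (expandTime N) _)) (sym (+-assoc (2 + expandTime N) _ 2))))
             (while-true≤ refl (expand≤ i) run)

module _ (G : Graph) (K : Tree) {v₀ : Graph.Vertex G}
         (last : toℕ v₀ ≡ len (tail (encodeGraph G))) where
  open Graph G

  private
    M : Tree
    M = encodeGraph G

  Close : ℕ → Vertex → Set
  Close i x = Σ (Walk G x v₀) λ w → walkLength G w ≤ i

  within⁻ : ∀ i x → Any (_≡ toℕ x) (codes (within M K i)) → Close i x
  within⁻ zero    x (here eq) rewrite Fin.toℕ-injective (trans (sym eq) (sym last)) = [] , z≤n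
  within⁻ (suc i) x a = step (find (proj₂ (Equivalence.to (within-suc M K i (toℕ x)) a)))
    where
    step : (∃[ w ] w ∈ codes (within M K i) × (w ≡ toℕ x ⊎ Entry M (toℕ x) w)) → Close (suc i) x
    step (w , w∈ , inj₁ refl) = let p , l = within⁻ i x (Any.map sym w∈) in p , m≤n⇒m≤1+n l
    step (w , w∈ , inj₂ e) with toℕ-image (entry-column G {x} {w} e)
    ... | y , refl = let p , l = within⁻ i y (Any.map sym w∈) in entry⁻ G e ∷ p , s≤s l

  within⁺ : ∀ i x → Close i x → Any (_≡ toℕ x) (codes (within M K i))
  within⁺ zero    x ([] , _) = here (sym last)
  within⁺ (suc i) x c =
    Equivalence.from (within-suc M K i (toℕ x)) (subst (toℕ x <_) (sym (len-encodeGraph G)) (Fin.toℕ<n x) , near c)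
    where
    near : Close (suc i) x → Near M K (within M K i) (toℕ x)
    near ([] , _)          = Any.map inj₁ (within⁺ i x ([] , z≤n))
    near (_∷_ {v = y} e p , s≤s l) =
      Any.map (λ w≡y → inj₂ (subst (Entry M (toℕ x)) (sym w≡y) (entry⁺ G e))) (within⁺ i y (p , l))

  -- Used twice: at the diameter, to guarantee that the search ends, and at the radius where it
  -- ended, to conclude that every vertex is close to the start.
  all-within : ∀ i → (¬ Holds unreached (view M K nil (within M K i))) ⇔ (∀ x → Close i x)
  all-within i = mk⇔
    (λ none x → within⁻ i x (decidable-stable (any? (_≟ toℕ x) _) (λ x∉ →
      none (Equivalence.from unreached⇔ (toℕ x , subst (toℕ x <_) (sym (len-encodeGraph G)) (Fin.toℕ<n x) , x∉)))))
    (λ close h → refute close (Equivalence.to unreached⇔ h))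
    where
    unreached⇔ : Holds unreached (view M K nil (within M K i)) ⇔
                 (∃[ x ] x < len M × ¬ Any (_≡ x) (codes (within M K i)))
    unreached⇔ = holds-unreached M K nil (within M K i) nil nil
    refute : (∀ x → Close i x) → ¬ (∃[ x ] x < len M × ¬ Any (_≡ x) (codes (within M K i)))
    refute close (x , x<n , x∉) with toℕ-image (subst (x <_) (len-encodeGraph G) x<n)
    ... | y , refl = x∉ (within⁺ i y (close y))

-- The decision program

decideCommand : Command 13
decideCommand =
  (#M := hd (var #R) ⨾ #K := tl (var #R) ⨾ #W := cons (tl (var #M)) nil) ⨾
  -- The search loop tests the result register, which must hold the truth value for radius zero
  -- before the first round.
  compile 6 unreached ⨾
  searchCommand ⨾
  countCommand ⨾
  treesCommand ⨾
  compile 6 certificate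

decideProgram : Program
decideProgram = record { auxiliary = 12 ; body = decideCommand }

decideTime : ℕ → ℕ
decideTime N =
  11 + (time unreached N + ((N * (2 + expandTime N) + 2) +
    (countTime N + (treesTime N + time certificate N))))

poly-decideTime : Polynomial decideTime
poly-decideTime =
  c 11 +ᵖ (poly-time unreached +ᵖ ((poly-id *ᵖ (c 2 +ᵖ poly-expandTime) +ᵖ c 2) +ᵖ
    (poly-countTime +ᵖ (poly-treesTime +ᵖ poly-time certificate))))
  where
  c = poly-const
  poly-visitTime : Polynomial visitTime
  poly-visitTime = c 4 +ᵖ (poly-time reachable +ᵖ c 12)
  poly-expandTime : Polynomial expandTime
  poly-expandTime = c 2 +ᵖ (c 2 +ᵖ ((poly-id *ᵖ (poly-visitTime +ᵖ c 5) +ᵖ c 2) +ᵖ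
    (c 2 +ᵖ (c 2 +ᵖ (c 4 +ᵖ poly-time unreached)))))
  loop : ∀ {T} a b → Polynomial T → Polynomial (λ N → a + (N * (T N + b) + 2))
  loop a b p = c a +ᵖ (poly-id *ᵖ (p +ᵖ c b) +ᵖ c 2)
  poly-countTime : Polynomial countTime
  poly-countTime = loop 2 5 (loop 2 5 (c 4 +ᵖ (poly-id *ᵖ c 29 +ᵖ c 2)))
  poly-treesTime : Polynomial treesTime
  poly-treesTime = c 4 +ᵖ loop 2 5 (c 4 +ᵖ (c 2 +ᵖ
    ((poly-id *ᵖ (c 2 +ᵖ (poly-id *ᵖ c 13 +ᵖ c 2) +ᵖ c 5) +ᵖ c 2) +ᵖ c 4)))

T-does : {P : Set} (d : Dec P) → T (does d) ⇔ P
T-does (yes p) = mk⇔ (λ _ → p) _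
T-does (no ¬p) = mk⇔ (λ ()) ¬p

len≤size : ∀ t → len t ≤ size t
len≤size nil     = z≤n
len≤size (l ∙ r) = s≤s (≤-trans (len≤size r) (m≤n+m (size r) (size l)))

Bounded-size : ∀ t → Bounded (size t) t
Bounded-size nil     = tt
Bounded-size (l ∙ r) =
  Bounded-mono (m≤n⇒m≤1+n (m≤m+n (size l) (size r))) l (Bounded-size l) ,
  Bounded-mono (m≤n⇒m≤1+n (m≤n+m (size r) (size l))) r (Bounded-size r) ,
  len≤size (l ∙ r)

size>0 : ∀ t → 0 < size t
size>0 nil     = z<s
size>0 (_ ∙ _) = z<s

Bounded-encodeℕ : ∀ {N} m → m ≤ N → Bounded N (encodeℕ m)
Bounded-encodeℕ zero    _   = tt
Bounded-encodeℕ (suc m) m<N = tt , Bounded-encodeℕ m (<⇒≤ m<N) , ≤-trans (≤-reflexive (cong suc (len-encodeℕ m))) m<N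

suc-len-tail : ∀ t → 0 < len t → suc (len (tail t)) ≡ len t
suc-len-tail (_ ∙ _) _ = refl

count-mono : ∀ k {d e} → d ≤ e → count k d ≤ count k e
count-mono k d≤e = *-monoʳ-≤ k (*-monoʳ-≤ k (s≤s d≤e))

-- The height up to which certificates are searched in a graph in which
-- every vertex is at distance at most e from the last one.
certificateHeight : ℕ → ℕ → ℕ
certificateHeight k e = count k e * 8 + 0

-- Correctness and running time on a given instance

module _ (i : SGSInstance) where
  open SGSInstance i
  open Graph graph
  open ShortestPath using (path)

  private
    n : ℕ
    n = order
    M K : Tree
    M = encodeGraph graph
    K = encodeℕ k
    instance
      k≢0 : NonZero k
      k≢0 = k-positive

    0<n : 0 < n
    0<n = ≤-<-trans z≤n (Fin.toℕ<n (proj₁ (proj₁ isDiameter)))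

    v₀,last : ∃[ v ] toℕ {n} v ≡ len (tail M)
    v₀,last = toℕ-image (≤-reflexive (trans (suc-len-tail M (subst (0 <_) (sym (len-encodeGraph graph)) 0<n))
                                            (len-encodeGraph graph)))
    v₀ : Vertex
    v₀ = proj₁ v₀,last
    last : toℕ v₀ ≡ len (tail M)
    last = proj₂ v₀,last

    close-D : ∀ x → Close graph K last D x
    close-D x = let s = shortestPath (Path.walk (connected x v₀)) in
      Path.walk (path s) , proj₂ isDiameter x v₀ _ (s , refl)

  σ : ℕ → Store 6
  σ e = nil ∷ M ∷ K ∷ within M K e ∷ encodeℕ (count k e * 2) ∷ trees (certificateHeight k e) ∷ []

  n≤2c⇒4n≤8c : ∀ c → n ≤ c * 2 → n + (n + (n + n)) ≤ c * 8 + 0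
  n≤2c⇒4n≤8c c le = ≤-trans (+-mono-≤ le (+-mono-≤ le (+-mono-≤ le le))) (≤-reflexive (eq c))
    where
    eq : ∀ c → c * 2 + (c * 2 + (c * 2 + c * 2)) ≡ c * 8 + 0
    eq = solve-∀

  Yes : Set
  Yes = ParameterizedProblem.YesInstance StrongGeodeticSet i

  module _ (e : ℕ) (close : ∀ x → Close graph K last e x) where

    -- Going from `u` to the start vertex of the search and on to `v` gives a walk of length at most
    -- 2e.
    short : ∀ {u v} (s : ShortestPath graph u v) → Path.length (path s) ≤ e + e
    short {u} {v} s = begin
      Path.length (path s)             ≤⟨ ShortestPath.shortest s (proj₁ p) ⟩
      Path.length (proj₁ p)            ≤⟨ proj₂ p ⟩
      walkLength graph (append a (reverse b)) ≡⟨ trans (length-append a (reverse b))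
                                                        (cong (walkLength graph a +_) (length-reverse b)) ⟩
      walkLength graph a + walkLength graph b ≤⟨ +-mono-≤ (proj₂ (close u)) (proj₂ (close v)) ⟩
      e + e                            ∎
      where
      open ≤-Reasoning
      a : Walk graph u v₀
      a = proj₁ (close u)
      b : Walk graph v v₀
      b = proj₁ (close v)
      p : Σ (Path graph u v) λ p → Path.length p ≤ walkLength graph (append a (reverse b))
      p = path≤ (append a (reverse b))

    -- As `k` is positive, k ≤ k², and so k + k²(2e + 1) ≤ 2k²(e + 1). This is the factor 2 in the
    -- order bound.
    yes⇒order≤ : Yes → n ≤ count k e * 2
    yes⇒order≤ (S , S≡k , geo) = begin
      n                                    ≤⟨ order≤ graph S geo short ⟩
      ∣ S ∣ + ∣ S ∣ * (∣ S ∣ * suc (e + e)) ≡⟨ cong (λ k → k + k * (k * suc (e + e))) S≡k ⟩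
      k + k * (k * suc (e + e))            ≤⟨ +-monoˡ-≤ _ (m≤m*n k k) ⟩
      k * k + k * (k * suc (e + e))        ≡⟨ eq k e ⟩
      count k e * 2                        ∎
      where
      open ≤-Reasoning
      eq : ∀ k e → k * k + k * (k * suc (e + e)) ≡ k * (k * suc e) * 2
      eq = solve-∀

    private
      H : ℕ
      H = certificateHeight k e

      len-bound : len (encodeℕ (count k e * 2)) ≡ count k e * 2
      len-bound = len-encodeℕ (count k e * 2)

    certificate-correct : Holds certificate (σ e) ⇔ Yes
    certificate-correct = mk⇔ sound complete ⇔-∘
      holds-certificate M K (trees H) (within M K e) (encodeℕ (count k e * 2)) nil
      where
      Certified : Set
      Certified = ¬ len (encodeℕ (count k e * 2)) < len M ×
                  Any (λ S → Any (Certifies M K (trees H) S) (elements (trees H))) (elements (trees H))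
      sound : Certified → Yes
      sound (n≤ , a) =
        let S , _ , b = find a
            P , _ , c = find b
            Ŝ , Ŝ≡ , geo = certificate-sound graph K (trees H) (∈-trees H)
              (n≤2c⇒4n≤8c (count k e) (subst₂ _≤_ (len-encodeGraph graph) len-bound (≮⇒≥ n≤))) S P c
        in Ŝ , trans Ŝ≡ (len-encodeℕ k) , geo
      complete : Yes → Certified
      complete y@(S , S≡k , geo) =
        let n≤ = yes⇒order≤ y
            Ŝ , Ŝ∈ , P , P∈ , c = certificate-complete graph S geo K (trees H) (∈-trees H)
              (n≤2c⇒4n≤8c (count k e) n≤) (trans S≡k (sym (len-encodeℕ k)))
        in ≤⇒≯ (subst₂ _≤_ (sym (len-encodeGraph graph)) (sym len-bound) n≤) , lose Ŝ∈ (lose P∈ c)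

  private
    -- A single bound for the lengths of all lists in the run. It is formed with `D`, which
    -- dominates whatever radius `e` the search returns.
    ℓ N : ℕ
    ℓ = numTrees (certificateHeight k D)
    N = size (M ∙ K) + ℓ

    bounded-M : Bounded N M
    bounded-M = Bounded-mono (≤-trans (m≤n⇒m≤1+n (m≤m+n (size M) (size K))) (m≤m+n _ ℓ)) M (Bounded-size M)

    bounded-K : Bounded N K
    bounded-K = Bounded-mono (≤-trans (m≤n⇒m≤1+n (m≤n+m (size K) (size M))) (m≤m+n _ ℓ)) K (Bounded-size K)

    0<N : 0 < N
    0<N = ≤-trans (size>0 (M ∙ K)) (m≤m+n _ ℓ)

    8c≤N : ∀ {e} → e ≤ D → count k e * 8 + 0 ≤ N
    8c≤N e≤D = begin
      count k _ * 8 + 0        ≤⟨ +-monoˡ-≤ 0 (*-monoˡ-≤ 8 (count-mono k e≤D)) ⟩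
      certificateHeight k D    ≤⟨ <⇒≤ (h<numTrees (certificateHeight k D)) ⟩
      ℓ                        ≤⟨ m≤n+m ℓ _ ⟩
      N                        ∎
      where open ≤-Reasoning

    e<N : ∀ {e} → e ≤ D → e < N
    e<N {e} e≤D = begin
      suc e               ≤⟨ m≤n*m (suc e) k ⟩
      k * suc e           ≤⟨ m≤n*m (k * suc e) k ⟩
      count k e           ≤⟨ m≤m*n (count k e) 8 ⟩
      count k e * 8       ≡⟨ sym (+-identityʳ _) ⟩
      count k e * 8 + 0   ≤⟨ 8c≤N e≤D ⟩
      N                   ∎
      where open ≤-Reasoning

    trees≤N : ∀ {e} → e ≤ D → numTrees (certificateHeight k e) ≤ N
    trees≤N e≤D = ≤-trans (numTrees-mono (+-monoˡ-≤ 0 (*-monoˡ-≤ 8 (count-mono k e≤D)))) (m≤n+m ℓ _)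

    2c≤N : ∀ {e} → e ≤ D → count k e * 2 ≤ N
    2c≤N {e} e≤D = ≤-trans (*-monoʳ-≤ (count k e) (s≤s (s≤s (z≤n {6})))) (≤-trans (m≤m+n _ 0) (8c≤N e≤D))

  private
    globals : ℕ → Vec Tree 5
    globals e = M ∷ K ∷ within M K e ∷ encodeℕ (count k e * 2) ∷ trees (certificateHeight k e) ∷ []

    scratch : ℕ → Vec Tree 6
    scratch e = encodeℕ e ∷ encodeℕ (certificateHeight k e) ∷ nil ∷ nil ∷ nil ∷ nil ∷ []

    counted : ℕ → ℕ → Store 13
    counted e c = nil ∷ nil ∷ M ∷ K ∷ within M K e ∷ encodeℕ (c * 2) ∷ nil ∷ encodeℕ e ∷ encodeℕ (c * 8 + 0) ∷
                  nil ∷ nil ∷ nil ∷ nil ∷ []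

    counting : ∀ e → e ≤ D → counted e 0 ⊢ countCommand ⇓ counted e (count k e) atMost countTime N
    counting e e≤D =
      subst₂ (λ k′ e′ → counted e 0 ⊢ countCommand ⇓ counted e (count k′ e′) atMost countTime N)
        (len-encodeℕ k) (len-encodeℕ e)
        (count≤ (Bounded-len K bounded-K) (subst (_< N) (sym (len-encodeℕ e)) (e<N e≤D)) 0)

    building : ∀ e → e ≤ D →
      counted e (count k e) ⊢ treesCommand ⇓ nil ∷ nil ∷ (globals e ++ scratch e) atMost treesTime N
    building e e≤D = trees≤ (certificateHeight k e) (trees≤N e≤D)

    checking : ∀ e → e ≤ D → nil ∷ nil ∷ (globals e ++ scratch e) ⊢ compile 6 certificate ⇓
      truth certificate (σ e) ∷ nil ∷ (globals e ++ scratch e) atMost time certificate N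
    checking e e≤D = compile≤ {6} {5} {N} certificate {nil} nil (globals e) (scratch e)
      (tt Vec.∷ bounded-M Vec.∷ bounded-K Vec.∷ within-bounded M K 0<N bounded-M bounded-K e Vec.∷
       Bounded-encodeℕ (count k e * 2) (2c≤N e≤D) Vec.∷
       trees-bounded (certificateHeight k e) (trees≤N e≤D) Vec.∷ Vec.[])

    searched : Found M K 0<N bounded-M bounded-K D D 0 (does (unreached? M K 0<N bounded-M bounded-K 0))
    searched = search≤′ M K 0<N bounded-M bounded-K
      (Equivalence.from (all-within graph K last D) close-D) D 0 refl

    input : Store 13
    input = (M ∙ K) ∷ replicate 12 nil

    starting : input ⊢ (#M := hd (var #R) ⨾ #K := tl (var #R) ⨾ #W := cons (tl (var #M)) nil) ⇓
               searching M K 0<N bounded-M bounded-K (M ∙ K) 0 0 atMost 3 + (3 + 5)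
    starting = assign≤ (hd (var #R)) ⨾≤ assign≤ (tl (var #R)) ⨾≤ assign≤ (cons (tl (var #M)) nil)

  decide≤ : ∃[ e ] (∀ x → Close graph K last e x) ×
    (input ⊢ decideCommand ⇓ truth certificate (σ e) ∷ nil ∷ (globals e ++ scratch e) atMost decideTime N)
  decide≤ =
    let e , e≤D , found , search = searched
    in e , Equivalence.to (all-within graph K last e) found ,
       (starting ⨾≤
        unreached≤ M K 0<N bounded-M bounded-K 0 0 ⨾≤
        relax (+-monoˡ-≤ 2 (*-monoˡ-≤ (2 + expandTime N) (<⇒≤ (e<N ≤-refl)))) search ⨾≤
        counting e e≤D ⨾≤ building e e≤D ⨾≤ checking e e≤D)

  module _ {C q : ℕ} (bound : ∀ N → decideTime N ≤ C * suc N ^ q) where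

    -- The power of the sum splits into a power of the input size and a power of the number of
    -- trees; the latter is one more than a number of trees of height larger by 2q. The constant
    -- collects a factor 2 for each `suc` removed: q times from the input size and once from the
    -- number of trees.
    decideTime≤ : decideTime N ≤ C * (2 ^ q * 2) * (boundFunction (q + q) D k * size (M ∙ K) ^ suc q)
    decideTime≤ = begin
      decideTime N                          ≤⟨ bound N ⟩
      C * suc (s + ℓ) ^ q                   ≤⟨ *-monoʳ-≤ C (^-monoˡ-≤ q (suc-+-≤ s ℓ)) ⟩
      C * (suc s * suc ℓ) ^ q               ≡⟨ cong (C *_) (*-^ (suc s) (suc ℓ) q) ⟩
      C * (suc s ^ q * suc ℓ ^ q)           ≤⟨ *-monoʳ-≤ C (*-mono-≤ (^-monoˡ-≤ q (suc≤2* 0<s))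
                                                                 (numTrees-^ q (certificateHeight k D))) ⟩
      C * ((2 * s) ^ q * suc g)             ≤⟨ *-monoʳ-≤ C (*-mono-≤ (≤-reflexive (*-^ 2 s q))
                                                 (suc≤2* (≤-<-trans z≤n (h<numTrees (q + q + certificateHeight k D))))) ⟩
      -- The exponent is raised by one because it has to be nonzero, also when `q` is zero.
      C * (2 ^ q * s ^ q * (2 * g))         ≤⟨ *-monoʳ-≤ C (*-monoˡ-≤ (2 * g) (*-monoʳ-≤ (2 ^ q)
                                                 (^-monoʳ-≤ s {{>-nonZero 0<s}} (n≤1+n q)))) ⟩
      C * (2 ^ q * s ^ suc q * (2 * g))     ≡⟨ rearrange C (2 ^ q) (s ^ suc q) g ⟩
      C * (2 ^ q * 2) * (g * s ^ suc q)     ≡⟨ cong (λ h → C * (2 ^ q * 2) * (numTrees h * s ^ suc q)) height≡ ⟩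
      C * (2 ^ q * 2) * (boundFunction (q + q) D k * s ^ suc q) ∎
      where
      open ≤-Reasoning
      s g : ℕ
      s = size (M ∙ K)
      g = numTrees (q + q + certificateHeight k D)
      0<s : 0 < s
      0<s = size>0 (M ∙ K)
      suc≤2* : ∀ {m} → 0 < m → suc m ≤ 2 * m
      suc≤2* {m} 0<m = ≤-trans (+-monoˡ-≤ m 0<m) (≤-reflexive (cong (m +_) (sym (+-identityʳ m))))
      rearrange : ∀ C p x g → C * (p * x * (2 * g)) ≡ C * (p * 2) * (g * x)
      rearrange = solve-∀
      height≡ : q + q + certificateHeight k D ≡ count k D * 8 + (q + q)
      height≡ = trans (+-comm (q + q) _) (cong (_+ (q + q)) (+-identityʳ (count k D * 8)))

-- The constant and the degree of the time bound may be arbitrary; the degree `q` then determines f,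
-- through the extra height `q + q`.
sgs-tractable : Polynomial decideTime → FixedParameterTractable StrongGeodeticSet
sgs-tractable (C , q , bound) =
  decideProgram , boundFunction (q + q) , suc q , C * (2 ^ q * 2) , boundComputable (q + q) , _ , λ i →
    let e , close , t , run , t≤ = decide≤ i in
    does (holds? certificate (σ i e)) , t , (_ , run , refl) ,
    (certificate-correct i e close ⇔-∘ T-does (holds? certificate (σ i e))) ,
    ≤-trans t≤ (decideTime≤ i {C} {q} bound)

theorem6 : FixedParameterTractable StrongGeodeticSet
theorem6 = sgs-tractable poly-decideTime
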